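{- Let $a,b,m\ge 1$ be integers. For non-negative integers $w,s,n$, let $\mathrm{cp}_{a,b,m}(w,s,n)$ be the number of $(a,b,m)$-copartitions $(\gamma,\rho,\sigma)$ of size $n$ such that $\gamma$ has exactly $w$ parts and $\sigma$ has exactly $s$ parts. Then $$\sum_{n=0}^\infty\sum_{w=0}^\infty\sum_{s=0}^\infty \mathrm{cp}_{a,b,m}(w,s,n)\,x^{s}y^{w}q^n=\frac{(xyq^{a+b};q^m)_\infty}{(xq^b;q^m)_\infty(yq^a;q^m)_\infty}.$$
   Context: A partition is a finite multiset of positive integers (its parts), possibly empty; its size $|\lambda|$ is the sum of its parts. For integers $a,b,m\ge 1$, an $(a,b,m)$-copartition is a triple of partitions $(\gamma,\rho,\sigma)$ such that each part of $\gamma$ is at least $a$ and congruent to $a \pmod m$, each part of $\sigma$ is at least $b$ and congruent to $b\pmod m$, and $\rho$ has the same number of parts as $\sigma$, each of which has size equal to $m$ times the number of parts of $\gamma$ (if $\gamma$ is empty, $\rho$ is regarded as empty). Its size is $|\gamma|+|\rho|+|\sigma|$. The parts of $\gamma$ are called ground parts and the parts of $\sigma$ sky parts. Notation: $(A;Q)_\infty=\prod_{k=0}^\infty(1-AQ^k)$. The identity may be read as an identity of formal power series in $q$ with coefficients in $\mathbb{Z}[x,y]$. -}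

module Defs where

open import Algebra.Bundles.Raw using (RawRing)
import Algebra.Definitions.RawSemiring as RawSemiringDefs
open import Data.Fin.Base using (Fin; toℕ)
import Data.Integer.Base as ℤ
open import Data.List.Base using (List; []; _∷_; length; map)
open import Data.List.Relation.Unary.All using (All)
open import Data.List.Relation.Unary.Linked using (Linked)
open import Data.Nat.Base as ℕ using (ℕ; zero; suc; NonZero; _≤_; _≥_; _<_; _%_; _∸_)
open import Data.Nat.ListAction using (sum)
open import Data.Product.Base using (_×_; Σ-syntax)
open import Function.Base using (_∘_)
open import Function.Bundles using (_↔_)
open import Level using (0ℓ)
open import Relation.Binary.PropositionalEquality.Core using (_≡_)

------------------------------------------------------------------------
-- Copartitions

-- A finite multiset of positive integers is represented by its unique
-- weakly decreasing listing.
record Partition : Set where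
  field
    parts      : List ℕ
    decreasing : Linked _≥_ parts
    positive   : All (0 <_) parts

  #parts : ℕ
  #parts = length parts

  size : ℕ
  size = sum parts

open Partition public using (parts; #parts)

∣_∣ : Partition → ℕ
∣_∣ = Partition.size

-- The number of parts of ρ, given the numbers of parts of γ and of σ:
-- ρ is empty when γ is.
#ρ-parts : ℕ → ℕ → ℕ
#ρ-parts zero    s = 0
#ρ-parts (suc _) s = s

record Copartition (a b m : ℕ) .{{_ : NonZero m}} : Set where
  field
    γ ρ σ   : Partition
    γ-parts : All (λ p → a ≤ p × p % m ≡ a % m) (parts γ)
    σ-parts : All (λ p → b ≤ p × p % m ≡ b % m) (parts σ)
    ρ-count : #parts ρ ≡ #ρ-parts (#parts γ) (#parts σ)
    ρ-parts : All (λ p → p ≡ m ℕ.* #parts γ) (parts ρ)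

  #ground : ℕ
  #ground = #parts γ

  #sky : ℕ
  #sky = #parts σ

  size : ℕ
  size = ∣ γ ∣ ℕ.+ ∣ ρ ∣ ℕ.+ ∣ σ ∣

-- All fields of the records above are propositions except the lists of
-- parts, so _≡_ on copartitions is equality of the triples (γ , ρ , σ),
-- and the bijection below says that cp w s n is the number of them.
CountsCopartitions : (a b m : ℕ) .{{_ : NonZero m}} → (ℕ → ℕ → ℕ → ℕ) → Set
CountsCopartitions a b m cp = ∀ w s n →
  Fin (cp w s n) ↔
  (Σ[ c ∈ Copartition a b m ] (#ground c ≡ w × #sky c ≡ s × size c ≡ n))
  where open Copartition

------------------------------------------------------------------------
-- Polynomials in one variable

module Polynomial {c ℓ} (R : RawRing c ℓ) where
  open RawRing R

  -- Coefficient lists, lowest degree first.  Trailing zeros are allowed,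
  -- hence equality is equality of all coefficients.
  Poly : Set c
  Poly = List Carrier

  coeff : Poly → ℕ → Carrier
  coeff []      _       = 0#
  coeff (k ∷ p) zero    = k
  coeff (k ∷ p) (suc i) = coeff p i

  infix  4 _≈ᵖ_
  infixl 6 _+ᵖ_
  infixl 7 _*ᵖ_

  _≈ᵖ_ : Poly → Poly → Set ℓ
  p ≈ᵖ r = ∀ i → coeff p i ≈ coeff r i

  _+ᵖ_ : Poly → Poly → Poly
  []      +ᵖ r       = r
  (k ∷ p) +ᵖ []      = k ∷ p
  (k ∷ p) +ᵖ (l ∷ r) = (k + l) ∷ (p +ᵖ r)

  _*ᵖ_ : Poly → Poly → Poly
  []      *ᵖ r = []
  (k ∷ p) *ᵖ r = map (k *_) r +ᵖ (0# ∷ p *ᵖ r)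

  constant : Carrier → Poly
  constant k = k ∷ []

  variable′ : Poly
  variable′ = 0# ∷ 1# ∷ []

  rawRing : RawRing c ℓ
  rawRing = record
    { Carrier = Poly
    ; _≈_     = _≈ᵖ_
    ; _+_     = _+ᵖ_
    ; _*_     = _*ᵖ_
    ; -_      = map -_
    ; 0#      = []
    ; 1#      = constant 1#
    }

------------------------------------------------------------------------
-- Formal power series in one variable

module PowerSeries {c ℓ} (R : RawRing c ℓ) where
  private
    module R where
      open RawRing R public
      open RawSemiringDefs rawSemiring public using (sum)

  Series : Set c
  Series = ℕ → R.Carrier

  constant : R.Carrier → Series
  constant k zero    = k
  constant k (suc _) = R.0#

  variable′ : Series
  variable′ (suc zero) = R.1#
  variable′ _          = R.0#

  rawRing : RawRing c ℓ
  rawRing = record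
    { Carrier = Series
    ; _≈_     = λ f g → ∀ n → f n R.≈ g n
    ; _+_     = λ f g n → f n R.+ g n
    ; _*_     = λ f g n → R.sum {suc n} (λ i → f (toℕ i) R.* g (n ∸ toℕ i))
    ; -_      = λ f n → R.- f n
    ; 0#      = λ _ → R.0#
    ; 1#      = constant R.1#
    }

  open RawRing rawRing public using (_≈_; _+_; _*_; -_; 0#; 1#)
  open RawSemiringDefs (RawRing.rawSemiring rawRing) public using (_^_; product)

  infixl 6 _-_
  infixl 7 _/_

  _-_ : Series → Series → Series
  f - g = f + (- g)

  -- Long division by a series g with constant term 1: with t the variable,
  -- f = f₀ + t f′ and g = 1 + t g′, the quotient is
  -- f / g = f₀ + t ((f′ - f₀ g′) / g).
  -- The value is meaningless for other g.
  _/_ : Series → Series → Series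
  (f / g) zero    = f 0
  (f / g) (suc n) = ((f ∘ suc - constant (f 0) * (g ∘ suc)) / g) n

  partialPochhammer : Series → Series → ℕ → Series
  partialPochhammer A Q N = product {N} (λ k → 1# - A * Q ^ toℕ k)

  -- The infinite product (A; Q)_∞ for Q without constant term: the factor
  -- 1 - A Qᵏ is then 1 up to terms of degree at least k, so the coefficient
  -- of degree n is the same in all partial products with more than n factors.
  pochhammer∞ : Series → Series → Series
  pochhammer∞ A Q n = partialPochhammer A Q (suc n) n

------------------------------------------------------------------------
-- The ring ℤ[x,y], realised as ℤ[x][y], and series in q over it

module ℤ[x] = Polynomial ℤ.+-*-rawRing
module ℤ[x,y] where
  open Polynomial ℤ[x].rawRing public
  open RawRing rawRing public using (_*_)
  open RawSemiringDefs (RawRing.rawSemiring rawRing) public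
    using (_^_; sum) renaming (_×_ to _·_)

  x y : Poly
  x = constant ℤ[x].variable′
  y = variable′

open PowerSeries ℤ[x,y].rawRing public

x y q : Series
x = constant ℤ[x,y].x
y = constant ℤ[x,y].y
q = variable′

-- The series ∑ₙ ∑_w ∑ₛ cp(w,s,n) xˢ y^w qⁿ.  A copartition of size n has at
-- most n ground parts and at most n sky parts, all parts being positive, so
-- in the coefficient of qⁿ only the terms with w , s ≤ n can be nonzero.
generatingSeries : (ℕ → ℕ → ℕ → ℕ) → Series
generatingSeries cp n =
  ℤ[x,y].sum {suc n} (λ w → ℤ[x,y].sum {suc n} (λ s →
    cp (toℕ w) (toℕ s) n · (X ^′ toℕ s *′ Y ^′ toℕ w)))
  where
  open ℤ[x,y] using (_·_) renaming (_^_ to _^′_; _*_ to _*′_; x to X; y to Y)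

{-# OPTIONS --safe #-}
module Submission where

-- Why the identity holds.
--
-- A partition with w parts, all at least a and congruent to a modulo m, is
-- the same as a tuple of w natural numbers: the differences of consecutive
-- parts, and of the last part and a, divided by m.  In these coordinates the
-- size is a w plus the sum of the m i jᵢ over 1 ≤ i ≤ w.  Since |ρ| = m w s, the
-- copartitions of size n with w ground and s sky parts correspond to the
-- solutions in natural numbers of
--
--   a w + m w s + b s + ∑ (m i) jᵢ + ∑ (m i) kᵢ = n   (i ≤ w, resp. i ≤ s),
--
-- and cp a b m w s n is defined as their number (cp-counts).
--
-- Splitting the solutions according to whether the coordinate of weight m w
-- (or that of weight m s) vanishes gives recurrences for these numbers
-- (count-sucˡ, count-sucʳ).  Let F_a be the generating series.  The
-- recurrences combine into cp-recurrence, which says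
--
--   (1 - y qᵃ) F_a = (1 - x y qᵃ⁺ᵇ) F_{a+m}.
--
-- Let G_b be the series of the terms of F_a free of y, which count partitions
-- σ alone and do not depend on a.  It satisfies (1 - x qᵇ) G_b = G_{b+m}
-- (skyCount-recurrence).  Iterating both equations N times gives
--
--   (y qᵃ; qᵐ)_N F_a = (x y qᵃ⁺ᵇ; qᵐ)_N F_{a+Nm},
--   (x qᵇ; qᵐ)_N G_b = G_{b+Nm}.
--
-- Modulo q^N, F_{a+Nm} is G_b (cp-limit) and G_{b+Nm} is 1 (skyCount-limit),
-- and the infinite products agree with their N-th partial products
-- (pochhammer∞-≈[]).  So F_a times the denominator is the numerator modulo
-- every q^N, and long division by a series with constant term 1 returns the
-- only series with this property (/-unique).
--
-- Series are compared with counting functions coefficient by coefficient, and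
-- ring identities are used in ℤ[x,y][[q]]; for these, power series and
-- coefficient lists over a commutative ring are shown to be commutative rings.

open import Algebra.Bundles using (CommutativeRing)
open import Algebra.Bundles.Raw using (RawRing)
import Algebra.Definitions.RawSemiring as RawSemiringDefs
import Algebra.Morphism.RingMonomorphism as RingMonomorphism
open import Algebra.Morphism.Structures using (IsRingMonomorphism)
import Algebra.Properties.CommutativeSemigroup as CommutativeSemigroupProperties
import Algebra.Properties.Monoid.Sum as MonoidSum
import Algebra.Properties.Ring as RingProperties
import Algebra.Properties.Semiring.Exp as Exponentiation
open import Data.Fin.Base using (Fin; toℕ)
open import Data.Fin.Properties using (+↔⊎)
import Data.Integer.Base as ℤ
import Data.Integer.Properties as ℤ
open import Data.List.Base as List using (List; []; _∷_; length; replicate)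
import Data.List.Properties as List
open import Data.List.Relation.Unary.All as All using (All; []; _∷_)
import Data.List.Relation.Unary.All.Properties as All
open import Data.List.Relation.Unary.Linked as Linked using (Linked; []; [-]; _∷_)
open import Data.Nat.Base as ℕ using (ℕ; zero; suc; _≤_; _<_; _≥_; z≤n; s≤s; NonZero)
import Data.Nat.DivMod as ℕ
import Data.Nat.Divisibility as ℕ
open import Data.Nat.ListAction using (sum)
import Data.Nat.Properties as ℕ
open import Data.Nat.Tactic.RingSolver using (solve-∀)
open import Data.Product.Base using (_×_; _,_; proj₁; proj₂; Σ-syntax)
open import Data.Sum.Base using (_⊎_; inj₁; inj₂)
open import Data.Sum.Function.Propositional using (_⊎-↔_)
open import Data.Vec.Base as Vec using (Vec; []; _∷_; toList; take; drop)
import Data.Vec.Properties as Vec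
open import Function.Base using (_∘_; id)
open import Function.Bundles using (_↔_; mk↔ₛ′)
open import Function.Properties.Inverse using (↔-trans; ↔-sym)
open import Relation.Binary.PropositionalEquality as ≡ using (_≡_; module ≡-Reasoning)
import Relation.Binary.Reasoning.Setoid as SetoidReasoning
open import Relation.Nullary.Irrelevant using (Irrelevant)

open import Defs using (module Polynomial; module PowerSeries;
  Partition; Copartition; #ρ-parts; parts; CountsCopartitions)

-- Power series and polynomials as commutative rings

-- The product satisfies (f g)₀ = f₀ g₀ and, with t the variable, f = f₀ + t f′
-- and g = g₀ + t g′, the tail of f g is f₀ g′ + f′ g.  Both hold by computation,
-- and every ring law follows from them by induction on the degree.
module SeriesRing {c ℓ} (R : CommutativeRing c ℓ) where
  private module R = CommutativeRing R
  open PowerSeries R.rawRing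
  open SetoidReasoning R.setoid
  open CommutativeSemigroupProperties R.+-commutativeSemigroup using (interchange)

  -- The coefficient of degree n of a product depends only on the coefficients
  -- of degree at most n of the factors.
  *-cong-at : ∀ n {f f′ g g′} →
    (∀ {i} → i ≤ n → f i R.≈ f′ i) → (∀ {i} → i ≤ n → g i R.≈ g′ i) →
    (f * g) n R.≈ (f′ * g′) n
  *-cong-at zero    f≈ g≈ = R.+-congʳ (R.*-cong (f≈ z≤n) (g≈ z≤n))
  *-cong-at (suc n) f≈ g≈ =
    R.+-cong (R.*-cong (f≈ z≤n) (g≈ ℕ.≤-refl))
             (*-cong-at n (f≈ ∘ s≤s) (g≈ ∘ ℕ.m≤n⇒m≤1+n))

  *-cong : ∀ {f f′ g g′} → f ≈ f′ → g ≈ g′ → f * g ≈ f′ * g′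
  *-cong f≈ g≈ n = *-cong-at n (λ {i} _ → f≈ i) (λ {i} _ → g≈ i)

  *-distribʳ : ∀ f g h → (g + h) * f ≈ g * f + h * f
  *-distribʳ f g h zero = begin
    (g 0 R.+ h 0) R.* f 0 R.+ R.0#
      ≈⟨ R.+-cong (R.distribʳ (f 0) (g 0) (h 0)) (R.sym (R.+-identityˡ R.0#)) ⟩
    (g 0 R.* f 0 R.+ h 0 R.* f 0) R.+ (R.0# R.+ R.0#)
      ≈⟨ interchange _ _ _ _ ⟩
    (g * f + h * f) 0 ∎
  *-distribʳ f g h (suc n) = begin
    (g 0 R.+ h 0) R.* f (suc n) R.+ ((g ∘ suc + h ∘ suc) * f) n
      ≈⟨ R.+-cong (R.distribʳ (f (suc n)) (g 0) (h 0))
                  (*-distribʳ f (g ∘ suc) (h ∘ suc) n) ⟩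
    (g 0 R.* f (suc n) R.+ h 0 R.* f (suc n))
      R.+ (((g ∘ suc) * f) n R.+ ((h ∘ suc) * f) n)
      ≈⟨ interchange _ _ _ _ ⟩
    (g * f + h * f) (suc n) ∎

  scale-* : ∀ k f g n → ((λ i → k R.* f i) * g) n R.≈ k R.* (f * g) n
  scale-* k f g zero = begin
    (k R.* f 0) R.* g 0 R.+ R.0#      ≈⟨ R.+-cong (R.*-assoc k (f 0) (g 0)) (R.sym (R.zeroʳ k)) ⟩
    k R.* (f 0 R.* g 0) R.+ k R.* R.0# ≈⟨ R.distribˡ k _ _ ⟨
    k R.* (f * g) 0 ∎
  scale-* k f g (suc n) = begin
    (k R.* f 0) R.* g (suc n) R.+ ((λ i → k R.* f (suc i)) * g) n
      ≈⟨ R.+-cong (R.*-assoc k (f 0) (g (suc n))) (scale-* k (f ∘ suc) g n) ⟩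
    k R.* (f 0 R.* g (suc n)) R.+ k R.* ((f ∘ suc) * g) n
      ≈⟨ R.distribˡ k _ _ ⟨
    k R.* (f * g) (suc n) ∎

  *-comm : ∀ f g → f * g ≈ g * f
  *-comm f g zero = R.+-congʳ (R.*-comm (f 0) (g 0))
  *-comm f g (suc zero) = begin
    f 0 R.* g 1 R.+ (f 1 R.* g 0 R.+ R.0#)
      ≈⟨ R.+-cong (R.trans (R.*-comm (f 0) (g 1)) (R.sym (R.+-identityʳ _)))
                  (R.trans (R.+-identityʳ _) (R.*-comm (f 1) (g 0))) ⟩
    (g 1 R.* f 0 R.+ R.0#) R.+ g 0 R.* f 1
      ≈⟨ R.+-comm _ _ ⟩
    g 0 R.* f 1 R.+ (g 1 R.* f 0 R.+ R.0#) ∎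
  -- The recursion takes the tail of the left factor only, so that commutativity
  -- at n + 2 needs the cases n + 1 (twice) and n.
  *-comm f g (suc (suc n)) = begin
    f 0 R.* g (2 ℕ.+ n) R.+ ((f ∘ suc) * g) (suc n)
      ≈⟨ R.+-congˡ (*-comm (f ∘ suc) g (suc n)) ⟩
    f 0 R.* g (2 ℕ.+ n) R.+ (g 0 R.* f (2 ℕ.+ n) R.+ ((g ∘ suc) * (f ∘ suc)) n)
      ≈⟨ R.+-assoc _ _ _ ⟨
    (f 0 R.* g (2 ℕ.+ n) R.+ g 0 R.* f (2 ℕ.+ n)) R.+ ((g ∘ suc) * (f ∘ suc)) n
      ≈⟨ R.+-cong (R.+-comm _ _) (*-comm (g ∘ suc) (f ∘ suc) n) ⟩
    (g 0 R.* f (2 ℕ.+ n) R.+ f 0 R.* g (2 ℕ.+ n)) R.+ ((f ∘ suc) * (g ∘ suc)) n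
      ≈⟨ R.+-assoc _ _ _ ⟩
    g 0 R.* f (2 ℕ.+ n) R.+ (f * (g ∘ suc)) (suc n)
      ≈⟨ R.+-congˡ (*-comm f (g ∘ suc) (suc n)) ⟩
    g 0 R.* f (2 ℕ.+ n) R.+ ((g ∘ suc) * f) (suc n) ∎

  *-assoc : ∀ f g h → (f * g) * h ≈ f * (g * h)
  *-assoc f g h zero = R.+-congʳ (begin
    (f 0 R.* g 0 R.+ R.0#) R.* h 0 ≈⟨ R.*-congʳ (R.+-identityʳ _) ⟩
    (f 0 R.* g 0) R.* h 0          ≈⟨ R.*-assoc _ _ _ ⟩
    f 0 R.* (g 0 R.* h 0)          ≈⟨ R.*-congˡ (R.+-identityʳ _) ⟨
    f 0 R.* (g 0 R.* h 0 R.+ R.0#) ∎)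
  *-assoc f g h (suc n) = begin
    (f 0 R.* g 0 R.+ R.0#) R.* h (suc n)
      R.+ (((λ i → f 0 R.* g (suc i)) + (f ∘ suc) * g) * h) n
      ≈⟨ R.+-cong
           (R.trans (R.*-congʳ (R.+-identityʳ _)) (R.*-assoc _ _ _))
           (*-distribʳ h (λ i → f 0 R.* g (suc i)) ((f ∘ suc) * g) n) ⟩
    f 0 R.* (g 0 R.* h (suc n))
      R.+ (((λ i → f 0 R.* g (suc i)) * h) n R.+ (((f ∘ suc) * g) * h) n)
      ≈⟨ R.+-congˡ (R.+-cong (scale-* (f 0) (g ∘ suc) h n) (*-assoc (f ∘ suc) g h n)) ⟩
    f 0 R.* (g 0 R.* h (suc n))
      R.+ (f 0 R.* ((g ∘ suc) * h) n R.+ ((f ∘ suc) * (g * h)) n)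
      ≈⟨ R.+-assoc _ _ _ ⟨
    (f 0 R.* (g 0 R.* h (suc n)) R.+ f 0 R.* ((g ∘ suc) * h) n)
      R.+ ((f ∘ suc) * (g * h)) n
      ≈⟨ R.+-congʳ (R.distribˡ (f 0) _ _) ⟨
    f 0 R.* (g * h) (suc n) R.+ ((f ∘ suc) * (g * h)) n ∎

  *-zeroˡ : ∀ f → 0# * f ≈ 0#
  *-zeroˡ f zero    = R.trans (R.+-identityʳ _) (R.zeroˡ _)
  *-zeroˡ f (suc n) = R.trans (R.+-cong (R.zeroˡ _) (*-zeroˡ f n)) (R.+-identityʳ _)

  constant-* : ∀ k f n → (constant k * f) n R.≈ k R.* f n
  constant-* k f zero    = R.+-identityʳ _
  constant-* k f (suc n) = R.trans (R.+-congˡ (*-zeroˡ f n)) (R.+-identityʳ _)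

  *-identityˡ : ∀ f → 1# * f ≈ f
  *-identityˡ f n = R.trans (constant-* R.1# f n) (R.*-identityˡ (f n))

  commutativeRing : CommutativeRing c ℓ
  commutativeRing = record
    { RawRing rawRing
    ; isCommutativeRing = record
      { isRing = record
        { +-isAbelianGroup = record
          { isGroup = record
            { isMonoid = record
              { isSemigroup = record
                { isMagma = record
                  { isEquivalence = record
                    { refl  = λ _ → R.refl
                    ; sym   = λ f≈g n → R.sym (f≈g n)
                    ; trans = λ f≈g g≈h n → R.trans (f≈g n) (g≈h n)
                    }
                  ; ∙-cong = λ f≈ g≈ n → R.+-cong (f≈ n) (g≈ n)
                  }
                ; assoc = λ f g h n → R.+-assoc (f n) (g n) (h n)
                }
              ; identity = (λ f n → R.+-identityˡ (f n)) , (λ f n → R.+-identityʳ (f n))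
              }
            ; inverse = (λ f n → R.-‿inverseˡ (f n)) , (λ f n → R.-‿inverseʳ (f n))
            ; ⁻¹-cong = λ f≈ n → R.-‿cong (f≈ n)
            }
          ; comm = λ f g n → R.+-comm (f n) (g n)
          }
        ; *-cong     = λ {f} {f′} {g} {g′} → *-cong {f} {f′} {g} {g′}
        ; *-assoc    = *-assoc
        ; *-identity = *-identityˡ , λ f n → R.trans (*-comm f 1# n) (*-identityˡ f n)
        ; distrib    = (λ f g h n → R.trans (*-comm f (g + h) n)
                         (R.trans (*-distribʳ f g h n)
                           (R.+-cong (*-comm g f n) (*-comm h f n))))
                     , *-distribʳ
        }
      ; *-comm = *-comm
      }
    }

  variable-*-zero : ∀ f → (variable′ * f) zero R.≈ R.0#
  variable-*-zero f = R.trans (R.+-identityʳ _) (R.zeroˡ _)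

  variable-*-suc : ∀ f n → (variable′ * f) (suc n) R.≈ f n
  variable-*-suc f n = begin
    R.0# R.* f (suc n) R.+ ((variable′ ∘ suc) * f) n
      ≈⟨ R.+-cong (R.zeroˡ _)
           (*-cong {variable′ ∘ suc} {1#} {f} {f} variable∘suc (λ _ → R.refl) n) ⟩
    R.0# R.+ (1# * f) n ≈⟨ R.+-identityˡ _ ⟩
    (1# * f) n          ≈⟨ *-identityˡ f n ⟩
    f n ∎
    where
    variable∘suc : variable′ ∘ suc ≈ 1#
    variable∘suc zero    = R.refl
    variable∘suc (suc _) = R.refl

  -- If h g = f then f₀ = h₀ and the tail of h is the quotient of f′ - f₀ g′ by g,
  -- as in the recursion that defines long division.
  /-unique : ∀ {f g h} → g 0 R.≈ R.1# → h * g ≈ f → h ≈ f / g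
  /-unique {f} {g} {h} g₀≈1 hg≈f zero = begin
    h 0                    ≈⟨ R.*-identityʳ _ ⟨
    h 0 R.* R.1#           ≈⟨ R.*-congˡ g₀≈1 ⟨
    h 0 R.* g 0            ≈⟨ R.+-identityʳ _ ⟨
    h 0 R.* g 0 R.+ R.0#   ≈⟨ hg≈f 0 ⟩
    f 0 ∎
  /-unique {f} {g} {h} g₀≈1 hg≈f (suc n) =
    /-unique {f ∘ suc - constant (f 0) * (g ∘ suc)} {g} {h ∘ suc} g₀≈1 tail-eq n
    where
    tail-eq : (h ∘ suc) * g ≈ f ∘ suc - constant (f 0) * (g ∘ suc)
    tail-eq i = begin
      ((h ∘ suc) * g) i
        ≈⟨ R.+-identityʳ _ ⟨
      ((h ∘ suc) * g) i R.+ R.0#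
        ≈⟨ R.+-congˡ (R.-‿inverseʳ (h 0 R.* g (suc i))) ⟨
      ((h ∘ suc) * g) i R.+ (h 0 R.* g (suc i) R.- h 0 R.* g (suc i))
        ≈⟨ R.+-assoc _ _ _ ⟨
      (((h ∘ suc) * g) i R.+ h 0 R.* g (suc i)) R.- h 0 R.* g (suc i)
        ≈⟨ R.+-congʳ (R.+-comm _ _) ⟩
      (h * g) (suc i) R.- h 0 R.* g (suc i)
        ≈⟨ R.+-cong (hg≈f (suc i))
             (R.-‿cong (R.trans (R.*-congʳ (/-unique {f} {g} {h} g₀≈1 hg≈f zero))
                                (R.sym (constant-* (f 0) (g ∘ suc) i)))) ⟩
      f (suc i) R.- (constant (f 0) * (g ∘ suc)) i ∎

-- Taking coefficients embeds polynomials into power series compatibly with all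
-- operations, so the ring laws for polynomials are inherited from those for series.
module PolynomialRing {c ℓ} (R : CommutativeRing c ℓ) where
  private
    module R = CommutativeRing R
    module S = PowerSeries R.rawRing
    module SR = CommutativeRing (SeriesRing.commutativeRing R)
  open Polynomial R.rawRing
  open RingProperties R.ring using (-0#≈0#)

  coeff-+ : ∀ p r i → coeff (p +ᵖ r) i R.≈ coeff p i R.+ coeff r i
  coeff-+ []      r       i       = R.sym (R.+-identityˡ _)
  coeff-+ (k ∷ p) []      i       = R.sym (R.+-identityʳ _)
  coeff-+ (k ∷ p) (l ∷ r) zero    = R.refl
  coeff-+ (k ∷ p) (l ∷ r) (suc i) = coeff-+ p r i

  coeff-scale : ∀ k p i → coeff (List.map (k R.*_) p) i R.≈ k R.* coeff p i
  coeff-scale k []      i       = R.sym (R.zeroʳ k)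
  coeff-scale k (l ∷ p) zero    = R.refl
  coeff-scale k (l ∷ p) (suc i) = coeff-scale k p i

  coeff-neg : ∀ p i → coeff (List.map R.-_ p) i R.≈ R.- coeff p i
  coeff-neg []      i       = R.sym -0#≈0#
  coeff-neg (k ∷ p) zero    = R.refl
  coeff-neg (k ∷ p) (suc i) = coeff-neg p i

  coeff-* : ∀ p r → coeff (p *ᵖ r) S.≈ coeff p S.* coeff r
  coeff-* []      r i       = R.sym (SR.zeroˡ (coeff r) i)
  coeff-* (k ∷ p) r zero    =
    R.trans (coeff-+ (List.map (k R.*_) r) _ 0) (R.+-congʳ (coeff-scale k r 0))
  coeff-* (k ∷ p) r (suc i) =
    R.trans (coeff-+ (List.map (k R.*_) r) _ (suc i))
            (R.+-cong (coeff-scale k r (suc i)) (coeff-* p r i))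

  coeff-constant : ∀ k → coeff (constant k) S.≈ S.constant k
  coeff-constant k zero    = R.refl
  coeff-constant k (suc i) = R.refl

  coeff-variable : coeff variable′ S.≈ S.variable′
  coeff-variable zero          = R.refl
  coeff-variable (suc zero)    = R.refl
  coeff-variable (suc (suc i)) = R.refl

  coeff-constant-* : ∀ k p i → coeff (constant k *ᵖ p) i R.≈ k R.* coeff p i
  coeff-constant-* k p i = begin
    coeff (constant k *ᵖ p) i           ≈⟨ coeff-* (constant k) p i ⟩
    (coeff (constant k) S.* coeff p) i  ≈⟨ SR.*-congʳ {coeff p} {coeff (constant k)} {S.constant k}
                                               (coeff-constant k) i ⟩
    (S.constant k S.* coeff p) i        ≈⟨ SeriesRing.constant-* R k (coeff p) i ⟩
    k R.* coeff p i ∎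
    where open SetoidReasoning R.setoid

  coeff-variable-* : ∀ p → coeff (variable′ *ᵖ p) S.≈ S.variable′ S.* coeff p
  coeff-variable-* p = SR.trans {coeff (variable′ *ᵖ p)} {coeff variable′ S.* coeff p}
    (coeff-* variable′ p) (SR.*-congʳ {coeff p} {coeff variable′} {S.variable′} coeff-variable)

  coeff-variable-*-zero : ∀ p → coeff (variable′ *ᵖ p) zero R.≈ R.0#
  coeff-variable-*-zero p =
    R.trans (coeff-variable-* p zero) (SeriesRing.variable-*-zero R (coeff p))

  coeff-variable-*-suc : ∀ p i → coeff (variable′ *ᵖ p) (suc i) R.≈ coeff p i
  coeff-variable-*-suc p i =
    R.trans (coeff-variable-* p (suc i)) (SeriesRing.variable-*-suc R (coeff p) i)

  coeff-isRingMonomorphism : IsRingMonomorphism rawRing S.rawRing coeff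
  coeff-isRingMonomorphism = record
    { isRingHomomorphism = record
      { isSemiringHomomorphism = record
        { isNearSemiringHomomorphism = record
          { +-isMonoidHomomorphism = record
            { isMagmaHomomorphism = record
              { isRelHomomorphism = record { cong = id }
              ; homo              = coeff-+
              }
            ; ε-homo = λ _ → R.refl
            }
          ; *-homo = coeff-*
          }
        ; 1#-homo = coeff-constant R.1#
        }
      ; -‿homo = coeff-neg
      }
    ; injective = id
    }

  commutativeRing : CommutativeRing c ℓ
  commutativeRing = record
    { RawRing rawRing
    ; isCommutativeRing =
        RingMonomorphism.isCommutativeRing coeff-isRingMonomorphism SR.isCommutativeRing
    }

-- Partial and infinite q-Pochhammer products

module FinitePochhammer {c ℓ} (T : CommutativeRing c ℓ) (Q : CommutativeRing.Carrier T) where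
  open CommutativeRing T
  open RawSemiringDefs (RawRing.rawSemiring rawRing) using (_^_; product)
  open SetoidReasoning setoid
  open CommutativeSemigroupProperties +-commutativeSemigroup using (interchange)
  open CommutativeSemigroupProperties *-commutativeSemigroup using (x∙yz≈y∙xz)
  open RingProperties ring using (-0#≈0#; [y-z]x≈yx-zx)

  -- (A; Q)_N, the product of the 1 - A Qᵏ over k < N.
  pochhammer : Carrier → ℕ → Carrier
  pochhammer A N = product {N} (λ k → 1# - A * Q ^ toℕ k)

  private
    factor-cong : ∀ {u v} → u ≈ v → 1# - u ≈ 1# - v
    factor-cong u≈v = +-congˡ (-‿cong u≈v)

    product-cong : ∀ {N} {f g : Fin N → Carrier} → (∀ i → f i ≈ g i) → product f ≈ product g
    product-cong = MonoidSum.sum-cong-≋ *-monoid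

  pochhammer-cong : ∀ {A B} → A ≈ B → ∀ N → pochhammer A N ≈ pochhammer B N
  pochhammer-cong A≈B N = product-cong {N} (λ _ → factor-cong (*-congʳ A≈B))

  pochhammer-suc : ∀ A N → pochhammer A (suc N) ≈ (1# - A) * pochhammer (A * Q) N
  pochhammer-suc A N = *-cong (factor-cong (*-identityʳ A))
    (product-cong {N} (λ k → factor-cong (sym (*-assoc A Q (Q ^ toℕ k)))))

  pochhammer-0# : ∀ N → pochhammer 0# N ≈ 1#
  pochhammer-0# zero    = refl
  pochhammer-0# (suc N) = begin
    pochhammer 0# (suc N)              ≈⟨ pochhammer-suc 0# N ⟩
    (1# - 0#) * pochhammer (0# * Q) N
      ≈⟨ *-cong (trans (+-congˡ -0#≈0#) (+-identityʳ 1#))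
                (trans (pochhammer-cong (zeroˡ Q) N) (pochhammer-0# N)) ⟩
    1# * 1#                            ≈⟨ *-identityˡ 1# ⟩
    1# ∎

  -- The form in which functional equations arise from counting, where there is
  -- no subtraction, turned into the form with factors 1 - A and 1 - B.
  factored : ∀ {A B f f′} → f + B * f′ ≈ A * f + f′ → (1# - A) * f ≈ (1# - B) * f′
  factored {A} {B} {f} {f′} eq = begin
    (1# - A) * f                       ≈⟨ [y-z]x≈yx-zx f 1# A ⟩
    1# * f - A * f                     ≈⟨ +-congʳ (*-identityˡ f) ⟩
    f - A * f                          ≈⟨ +-identityʳ _ ⟨
    (f - A * f) + 0#                   ≈⟨ +-congˡ (-‿inverseʳ (B * f′)) ⟨
    (f - A * f) + (B * f′ - B * f′)    ≈⟨ interchange f _ (B * f′) _ ⟩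
    (f + B * f′) + (- (A * f) - B * f′) ≈⟨ +-congʳ eq ⟩
    (A * f + f′) + (- (A * f) - B * f′) ≈⟨ interchange (A * f) f′ _ _ ⟩
    (A * f - A * f) + (f′ - B * f′)    ≈⟨ +-congʳ (-‿inverseʳ (A * f)) ⟩
    0# + (f′ - B * f′)                 ≈⟨ +-identityˡ _ ⟩
    f′ - B * f′                        ≈⟨ +-congʳ (*-identityˡ f′) ⟨
    1# * f′ - B * f′                   ≈⟨ [y-z]x≈yx-zx f′ 1# B ⟨
    (1# - B) * f′ ∎

  -- A q-difference equation for F, iterated N times.  The sequences A and B are
  -- geometric with ratio Q.
  iterate : (A B F : ℕ → Carrier) →
    (∀ i → A i * Q ≈ A (suc i)) → (∀ i → B i * Q ≈ B (suc i)) →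
    (∀ i → (1# - A i) * F i ≈ (1# - B i) * F (suc i)) →
    ∀ N → pochhammer (A 0) N * F 0 ≈ pochhammer (B 0) N * F N
  iterate A B F AQ BQ step zero    = refl
  iterate A B F AQ BQ step (suc N) = begin
    pochhammer (A 0) (suc N) * F 0
      ≈⟨ *-congʳ (peel A AQ) ⟩
    ((1# - A 0) * pochhammer (A 1) N) * F 0
      ≈⟨ trans (*-congʳ (*-comm _ _)) (*-assoc _ _ _) ⟩
    pochhammer (A 1) N * ((1# - A 0) * F 0)
      ≈⟨ *-congˡ (step 0) ⟩
    pochhammer (A 1) N * ((1# - B 0) * F 1)
      ≈⟨ x∙yz≈y∙xz _ _ _ ⟩
    (1# - B 0) * (pochhammer (A 1) N * F 1)
      ≈⟨ *-congˡ (iterate (A ∘ suc) (B ∘ suc) (F ∘ suc) (AQ ∘ suc) (BQ ∘ suc) (step ∘ suc) N) ⟩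
    (1# - B 0) * (pochhammer (B 1) N * F (suc N))
      ≈⟨ *-assoc _ _ _ ⟨
    ((1# - B 0) * pochhammer (B 1) N) * F (suc N)
      ≈⟨ *-congʳ (peel B BQ) ⟨
    pochhammer (B 0) (suc N) * F (suc N) ∎
    where
    peel : (A : ℕ → Carrier) → (∀ i → A i * Q ≈ A (suc i)) →
      pochhammer (A 0) (suc N) ≈ (1# - A 0) * pochhammer (A 1) N
    peel A AQ = trans (pochhammer-suc (A 0) N) (*-congˡ (pochhammer-cong (AQ 0) N))

module Truncation {c ℓ} (R : CommutativeRing c ℓ) where
  private module R = CommutativeRing R
  open PowerSeries R.rawRing
  open SeriesRing R

  infix 4 _≈[_]_

  -- Congruence modulo the N-th power of the variable.
  _≈[_]_ : Series → ℕ → Series → Set ℓ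
  f ≈[ N ] g = ∀ {n} → n < N → f n R.≈ g n

  *-cong-[] : ∀ {f f′ g g′} N → f ≈[ N ] f′ → g ≈[ N ] g′ → f * g ≈[ N ] f′ * g′
  *-cong-[] N f≈ g≈ {n} n<N =
    *-cong-at n (λ i≤n → f≈ (ℕ.≤-<-trans i≤n n<N)) (λ i≤n → g≈ (ℕ.≤-<-trans i≤n n<N))

  *-congˡ-[] : ∀ f {g g′} N → g ≈[ N ] g′ → f * g ≈[ N ] f * g′
  *-congˡ-[] f {g} {g′} N = *-cong-[] {f} {f} {g} {g′} N (λ _ → R.refl)

  *-vanishing : ∀ {f} g → f 0 R.≈ R.0# → (g * f) 0 R.≈ R.0#
  *-vanishing g f₀≈0 =
    R.trans (R.+-identityʳ _) (R.trans (R.*-congˡ f₀≈0) (R.zeroʳ (g 0)))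

  variable-^-vanishing : ∀ k .{{_ : NonZero k}} → (variable′ ^ k) 0 R.≈ R.0#
  variable-^-vanishing (suc k) = variable-*-zero (variable′ ^ k)

  module _ (Q : Series) (Q₀≈0 : Q 0 R.≈ R.0#) where
    private
      module SR = CommutativeRing commutativeRing
      module P = FinitePochhammer commutativeRing Q

    *-raises-order : ∀ {A} d → A ≈[ d ] 0# → A * Q ≈[ suc d ] 0#
    *-raises-order {A} d A≈0 {n} n<1+d = R.trans (step n) (lower n n<1+d)
      where
      Q′ : Series
      Q′ = Q ∘ suc
      Q≈ : Q ≈ variable′ * Q′
      Q≈ zero    = R.trans Q₀≈0 (R.sym (variable-*-zero Q′))
      Q≈ (suc n) = R.sym (variable-*-suc Q′ n)
      step : A * Q ≈ variable′ * (A * Q′)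
      step = begin
        A * Q                ≈⟨ SR.*-congˡ {A} {Q} {variable′ * Q′} Q≈ ⟩
        A * (variable′ * Q′) ≈⟨ x∙yz≈y∙xz A variable′ Q′ ⟩
        variable′ * (A * Q′) ∎
        where
        open SetoidReasoning SR.setoid
        open CommutativeSemigroupProperties SR.*-commutativeSemigroup using (x∙yz≈y∙xz)
      lower : ∀ n → n < suc d → (variable′ * (A * Q′)) n R.≈ R.0#
      lower zero    _         = variable-*-zero (A * Q′)
      lower (suc n) (s≤s n<d) = R.trans (variable-*-suc (A * Q′) n)
        (R.trans (*-cong-[] {A} {0#} {Q′} {Q′} d A≈0 (λ _ → R.refl) n<d) (SR.zeroˡ Q′ n))

    -- The extra factor is 1 - A Q^N, and A Q^N is divisible by t^(d+N) for t the
    -- variable.  In the induction on N, A is replaced by A Q, which raises d.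
    partialPochhammer-stable : ∀ {A} d N → A ≈[ d ] 0# →
      partialPochhammer A Q (suc N) ≈[ d ℕ.+ N ] partialPochhammer A Q N
    partialPochhammer-stable {A} d zero A≈0 {n} n<d = begin
      partialPochhammer A Q 1 n
        ≈⟨ P.pochhammer-suc A 0 n ⟩
      ((1# - A) * 1#) n
        ≈⟨ SR.*-identityʳ (1# - A) n ⟩
      1# n R.- A n
        ≈⟨ R.+-congˡ (R.-‿cong (A≈0 (≡.subst (n <_) (ℕ.+-identityʳ d) n<d))) ⟩
      1# n R.- R.0#
        ≈⟨ R.+-congˡ -0#≈0# ⟩
      1# n R.+ R.0#
        ≈⟨ R.+-identityʳ (1# n) ⟩
      1# n ∎
      where
      open SetoidReasoning R.setoid
      open RingProperties R.ring using (-0#≈0#)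
    partialPochhammer-stable {A} d (suc N) A≈0 {n} n<d+1+N = begin
      partialPochhammer A Q (suc (suc N)) n
        ≈⟨ P.pochhammer-suc A (suc N) n ⟩
      ((1# - A) * partialPochhammer (A * Q) Q (suc N)) n
        ≈⟨ *-congˡ-[] (1# - A) {partialPochhammer (A * Q) Q (suc N)} {partialPochhammer (A * Q) Q N}
             (suc d ℕ.+ N) (partialPochhammer-stable {A * Q} (suc d) N (*-raises-order {A} d A≈0))
             (≡.subst (n <_) (ℕ.+-suc d N) n<d+1+N) ⟩
      ((1# - A) * partialPochhammer (A * Q) Q N) n
        ≈⟨ P.pochhammer-suc A N n ⟨
      partialPochhammer A Q (suc N) n ∎
      where open SetoidReasoning R.setoid

    pochhammer∞-≈[] : ∀ A N → pochhammer∞ A Q ≈[ N ] partialPochhammer A Q N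
    pochhammer∞-≈[] A (suc N) {n} (s≤s n≤N) with ℕ.m≤n⇒m<n∨m≡n n≤N
    ... | inj₂ ≡.refl = R.refl
    ... | inj₁ n<N    = R.trans (pochhammer∞-≈[] A N n<N)
                                (R.sym (partialPochhammer-stable {A} 0 N (λ ()) n<N))

    pochhammer∞-0 : ∀ A → A 0 R.≈ R.0# → pochhammer∞ A Q 0 R.≈ R.1#
    pochhammer∞-0 A A₀≈0 = partialPochhammer-stable {A} 1 0 (λ { (s≤s z≤n) → A₀≈0 }) (s≤s z≤n)

open ≡ using (refl; sym; trans; cong; cong₂; subst)

-- Solutions of linear equations in natural numbers

module Counting where
  open import Data.Nat.Base using (_+_; _*_)

  -- count k us n is the number of tuples v of natural numbers, one for each entry
  -- of us, with k + ∑ vᵢ (uᵢ + 1) = n: the list us holds the predecessors of the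
  -- weights, which are thereby positive.  The equation for a nonempty list and a
  -- successor separates the tuples with first coordinate 0 from the others, whose
  -- first coordinate is lowered by 1; the recursion is then structural.
  count : ℕ → List ℕ → ℕ → ℕ
  count zero    []       zero    = 1
  count zero    []       (suc n) = 0
  count zero    (u ∷ us) zero    = count zero us zero
  count zero    (u ∷ us) (suc n) = count zero us (suc n) + count u (u ∷ us) n
  count (suc k) us       zero    = 0
  count (suc k) us       (suc n) = count k us n

  -- ∑ vᵢ (uᵢ + 1).
  dot : ∀ {l} → Vec ℕ l → Vec ℕ l → ℕ
  dot []       []       = 0
  dot (u ∷ us) (v ∷ vs) = v * suc u + dot us vs

  dot-++ : ∀ {k l} (us : Vec ℕ k) (us′ : Vec ℕ l) vs vs′ →
    dot (us Vec.++ us′) (vs Vec.++ vs′) ≡ dot us vs + dot us′ vs′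
  dot-++ []       us′ []       vs′ = refl
  dot-++ (u ∷ us) us′ (v ∷ vs) vs′ =
    trans (cong (v * suc u +_) (dot-++ us us′ vs vs′)) (sym (ℕ.+-assoc (v * suc u) _ _))

  -- The tuples enumerated by count.
  Solution : ∀ {l} → ℕ → Vec ℕ l → ℕ → Set
  Solution {l} k us n = Σ[ v ∈ Vec ℕ l ] k + dot us v ≡ n

  Solution-≡ : ∀ {l k n} {us : Vec ℕ l} {s t : Solution k us n} → proj₁ s ≡ proj₁ t → s ≡ t
  Solution-≡ {s = v , p} {t = .v , q} refl = cong (v ,_) (ℕ.≡-irrelevant p q)

  private
    first-zero : ∀ {l} u (us : Vec ℕ l) → Solution zero (u ∷ us) zero ↔ Solution zero us zero
    first-zero u us = mk↔ₛ′ (λ { (zero ∷ v , eq) → v , eq }) (λ (v , eq) → zero ∷ v , eq)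
      (λ _ → refl) (λ { (zero ∷ v , eq) → refl })

    first-cases : ∀ {l} u (us : Vec ℕ l) n →
      Solution zero (u ∷ us) (suc n) ↔ (Solution zero us (suc n) ⊎ Solution u (u ∷ us) n)
    first-cases u us n = mk↔ₛ′
      (λ { (zero ∷ v , eq) → inj₁ (v , eq)
         ; (suc i ∷ v , eq) → inj₂ (i ∷ v ,
             trans (sym (ℕ.+-assoc u (i * suc u) (dot us v))) (ℕ.suc-injective eq)) })
      (λ { (inj₁ (v , eq)) → zero ∷ v , eq
         ; (inj₂ (i ∷ v , eq)) → suc i ∷ v ,
             cong suc (trans (ℕ.+-assoc u (i * suc u) (dot us v)) eq) })
      (λ { (inj₁ _) → refl ; (inj₂ (i ∷ v , _)) → cong inj₂ (Solution-≡ {us = u ∷ us} refl) })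
      (λ { (zero ∷ v , eq) → refl ; (suc i ∷ v , eq) → Solution-≡ {us = u ∷ us} refl })

    shift : ∀ {l} k (us : Vec ℕ l) n → Solution (suc k) us (suc n) ↔ Solution k us n
    shift k us n = mk↔ₛ′ (λ (v , eq) → v , ℕ.suc-injective eq) (λ (v , eq) → v , cong suc eq)
      (λ _ → Solution-≡ {us = us} refl) (λ _ → Solution-≡ {us = us} refl)

  count-↔ : ∀ {l} k (us : Vec ℕ l) n → Fin (count k (toList us) n) ↔ Solution k us n
  count-↔ zero    []       zero    = mk↔ₛ′ (λ _ → [] , refl) (λ _ → Fin.zero)
    (λ { ([] , refl) → refl }) (λ { Fin.zero → refl ; (Fin.suc ()) })
  count-↔ zero    []       (suc n) = mk↔ₛ′ (λ ()) (λ { ([] , ()) }) (λ { ([] , ()) }) (λ ())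
  count-↔ zero    (u ∷ us) zero    = ↔-trans (count-↔ zero us zero) (↔-sym (first-zero u us))
  count-↔ zero    (u ∷ us) (suc n) =
    ↔-trans (+↔⊎ {count zero (toList us) (suc n)} {count u (u ∷ toList us) n})
      (↔-trans (count-↔ zero us (suc n) ⊎-↔ count-↔ u (u ∷ us) n)
        (↔-sym (first-cases u us n)))
  count-↔ (suc k) us       zero    = mk↔ₛ′ (λ ()) (λ { (_ , ()) }) (λ { (_ , ()) }) (λ ())
  count-↔ (suc k) us       (suc n) = ↔-trans (count-↔ k us n) (↔-sym (shift k us n))

  count-< : ∀ k us {n} → n < k → count k us n ≡ 0
  count-< (suc k) us {zero}  _         = refl
  count-< (suc k) us {suc n} (s≤s n<k) = count-< k us n<k

  count-∷ : ∀ k u us n →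
    count k (u ∷ us) n ≡ count k us n + count (k + suc u) (u ∷ us) n
  count-∷ zero    u us zero    = sym (ℕ.+-identityʳ _)
  count-∷ zero    u us (suc n) = refl
  count-∷ (suc k) u us zero    = refl
  count-∷ (suc k) u us (suc n) = count-∷ k u us n

  -- The tuples counted by count k (ts ++ u ∷ us) either vanish at the coordinate
  -- of u, or that coordinate can be lowered by 1.
  count-insert : ∀ k ts u us n →
    count k (ts List.++ u ∷ us) n
      ≡ count k (ts List.++ us) n + count (k + suc u) (ts List.++ u ∷ us) n
  count-insert k       []       u us n       = count-∷ k u us n
  count-insert (suc k) (t ∷ ts) u us zero    = refl
  count-insert (suc k) (t ∷ ts) u us (suc n) = count-insert k (t ∷ ts) u us n
  count-insert zero    (t ∷ ts) u us zero    = count-insert zero ts u us zero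
  count-insert zero    (t ∷ ts) u us (suc n) = begin
    count 0 W (suc n) + count t (t ∷ W) n
      ≡⟨ cong₂ _+_ (count-insert zero ts u us (suc n)) (count-insert t (t ∷ ts) u us n) ⟩
    (A + count u W n) + (B + count (t + suc u) (t ∷ W) n)
      ≡⟨ cong (λ k → (A + count u W n) + (B + count k (t ∷ W) n)) (t+[1+u]≡u+[1+t] t u) ⟩
    (A + count u W n) + (B + count (u + suc t) (t ∷ W) n)
      ≡⟨ interchange A _ B _ ⟩
    (A + B) + (count u W n + count (u + suc t) (t ∷ W) n)
      ≡⟨ cong (A + B +_) (count-∷ u t W n) ⟨
    (A + B) + count u (t ∷ W) n ∎
    where
    open ≡-Reasoning
    W : List ℕ
    W = ts List.++ u ∷ us
    A B : ℕ
    A = count 0 (ts List.++ us) (suc n)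
    B = count t (t ∷ ts List.++ us) n
    t+[1+u]≡u+[1+t] : ∀ t u → t + suc u ≡ u + suc t
    t+[1+u]≡u+[1+t] = solve-∀
    interchange : ∀ a b c d → (a + b) + (c + d) ≡ (a + c) + (b + d)
    interchange = solve-∀

  -- The predecessor of m (i + 1), for positive m.
  weight : ℕ → ℕ → ℕ
  weight m i = i + ℕ.pred m * suc i

  suc-weight : ∀ m i .{{_ : NonZero m}} → suc (weight m i) ≡ m * suc i
  suc-weight m i = cong (_* suc i) (ℕ.suc-pred m)

  -- The predecessors of m (i + 1), m (i + 2), …, m (i + w), for positive m.
  weights : ℕ → ℕ → (w : ℕ) → Vec ℕ w
  weights m i zero    = []
  weights m i (suc w) = weight m i ∷ weights m (suc i) w

  weights-∷ʳ : ∀ m i w us → toList (weights m i (suc w)) List.++ us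
    ≡ toList (weights m i w) List.++ weight m (i + w) ∷ us
  weights-∷ʳ m i zero    us = cong (λ i → weight m i ∷ us) (sym (ℕ.+-identityʳ i))
  weights-∷ʳ m i (suc w) us = cong (weight m i ∷_)
    (trans (weights-∷ʳ m (suc i) w us)
      (cong (λ j → toList (weights m (suc i) w) List.++ weight m j ∷ us) (sym (ℕ.+-suc i w))))

  -- The predecessors of the weights m, 2 m, …, w m of the ground coordinates, followed
  -- by those of the weights m, 2 m, …, s m of the sky coordinates.
  cpWeights : ℕ → ℕ → ℕ → List ℕ
  cpWeights m w s = toList (weights m 0 w) List.++ toList (weights m 0 s)

  -- The size of the smallest copartition with w ground and s sky parts.
  offset : (a b m w s : ℕ) → ℕ
  offset a b m w s = a * w + s * (m * w) + b * s

  module _ (m : ℕ) .{{_ : NonZero m}} where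

    -- The cases in which the ground coordinate of weight m (w + 1) is zero or not.
    count-sucˡ : ∀ k w s n → count k (cpWeights m (suc w) s) n
      ≡ count k (cpWeights m w s) n + count (k + m * suc w) (cpWeights m (suc w) s) n
    count-sucˡ k w s n
      rewrite weights-∷ʳ m 0 w (toList (weights m 0 s)) | sym (suc-weight m w)
      = count-insert k (toList (weights m 0 w)) (weight m w) (toList (weights m 0 s)) n

    -- The cases in which the sky coordinate of weight m (s + 1) is zero or not.
    count-sucʳ : ∀ k w s n → count k (cpWeights m w (suc s)) n
      ≡ count k (cpWeights m w s) n + count (k + m * suc s) (cpWeights m w (suc s)) n
    count-sucʳ k w s n = begin
      count k (cpWeights m w (suc s)) n
        ≡⟨ cong (λ us → count k us n) list-eq ⟩
      count k (W List.++ S List.++ u ∷ []) n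
        ≡⟨ cong (λ us → count k us n) (List.++-assoc W S _) ⟨
      count k ((W List.++ S) List.++ u ∷ []) n
        ≡⟨ count-insert k (W List.++ S) u [] n ⟩
      count k ((W List.++ S) List.++ []) n + count (k + suc u) ((W List.++ S) List.++ u ∷ []) n
        ≡⟨ cong₂ (λ us vs → count k us n + count (k + suc u) vs n)
             (List.++-identityʳ _) (trans (List.++-assoc W S _) (sym list-eq)) ⟩
      count k (cpWeights m w s) n + count (k + suc u) (cpWeights m w (suc s)) n
        ≡⟨ cong (λ v → count k (cpWeights m w s) n + count (k + v) (cpWeights m w (suc s)) n)
             (suc-weight m s) ⟩
      count k (cpWeights m w s) n + count (k + m * suc s) (cpWeights m w (suc s)) n ∎
      where
      open ≡-Reasoning
      W S : List ℕ
      W = toList (weights m 0 w)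
      S = toList (weights m 0 s)
      u : ℕ
      u = weight m s
      list-eq : cpWeights m w (suc s) ≡ W List.++ S List.++ u ∷ []
      list-eq = cong (W List.++_) (trans (sym (List.++-identityʳ _)) (weights-∷ʳ m 0 s []))

open Counting

-- The number of (a,b,m)-copartitions of size n with w ground and s sky parts.
cp : (a b m w s n : ℕ) → ℕ
cp a b m w s = count (offset a b m w s) (cpWeights m w s)

-- Copartitions as solutions of a linear equation

-- Partitions whose parts are at least a and congruent to a modulo m.
module Progression (a m : ℕ) .{{_ : NonZero m}} where
  open import Data.Nat.Base using (_+_; _*_; _∸_; _/_; _%_)

  InProgression : ℕ → Set
  InProgression p = a ≤ p × p % m ≡ a % m

  -- The partition with prescribed differences: the i-th part is a plus m times the
  -- sum of the i-th and all later entries.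
  toParts : ∀ {w} → Vec ℕ w → List ℕ
  toParts []       = []
  toParts (j ∷ js) = a + (j + Vec.sum js) * m ∷ toParts js

  -- The first part, or a if there is none: the quantity from which the difference
  -- of a preceding part is taken.
  bottom : List ℕ → ℕ
  bottom []      = a
  bottom (p ∷ _) = p

  -- The differences of consecutive parts divided by m.  The length w is an argument
  -- in order that fromParts-toParts needs no transport; the value does not matter for
  -- lists of other lengths.
  fromParts : ∀ w → List ℕ → Vec ℕ w
  fromParts zero    _        = []
  fromParts (suc w) []       = 0 ∷ fromParts w []
  fromParts (suc w) (p ∷ ps) = (p ∸ bottom ps) / m ∷ fromParts w ps

  length-toParts : ∀ {w} (js : Vec ℕ w) → length (toParts js) ≡ w
  length-toParts []       = refl
  length-toParts (j ∷ js) = cong suc (length-toParts js)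

  bottom-toParts : ∀ {w} (js : Vec ℕ w) → bottom (toParts js) ≡ a + Vec.sum js * m
  bottom-toParts []       = sym (ℕ.+-identityʳ a)
  bottom-toParts (j ∷ js) = refl

  toParts-decreasing : ∀ {w} (js : Vec ℕ w) → Linked _≥_ (toParts js)
  toParts-decreasing []            = []
  toParts-decreasing (j ∷ [])      = [-]
  toParts-decreasing (j ∷ i ∷ js) =
    ℕ.+-monoʳ-≤ a (ℕ.*-monoˡ-≤ m (ℕ.m≤n+m (i + Vec.sum js) j)) ∷ toParts-decreasing (i ∷ js)

  toParts-inProgression : ∀ {w} (js : Vec ℕ w) → All InProgression (toParts js)
  toParts-inProgression []       = []
  toParts-inProgression (j ∷ js) =
    (ℕ.m≤m+n a _ , ℕ.[m+kn]%n≡m%n a (j + Vec.sum js) m) ∷ toParts-inProgression js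

  fromParts-toParts : ∀ {w} (js : Vec ℕ w) → fromParts w (toParts js) ≡ js
  fromParts-toParts []       = refl
  fromParts-toParts (j ∷ js) = cong₂ _∷_ head-eq (fromParts-toParts js)
    where
    open ≡-Reasoning
    S : ℕ
    S = Vec.sum js
    head-eq : (a + (j + S) * m ∸ bottom (toParts js)) / m ≡ j
    head-eq = begin
      (a + (j + S) * m ∸ bottom (toParts js)) / m
        ≡⟨ cong (λ b → (a + (j + S) * m ∸ b) / m) (bottom-toParts js) ⟩
      (a + (j + S) * m ∸ (a + S * m)) / m
        ≡⟨ cong (_/ m) (ℕ.[m+n]∸[m+o]≡n∸o a _ _) ⟩
      ((j + S) * m ∸ S * m) / m
        ≡⟨ cong (_/ m) (ℕ.*-distribʳ-∸ m (j + S) S) ⟨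
      (j + S ∸ S) * m / m
        ≡⟨ ℕ.m*n/n≡m _ m ⟩
      j + S ∸ S
        ≡⟨ ℕ.m+n∸n≡m j S ⟩
      j ∎

  ≡-mod⇒∣-∸ : ∀ p b → p % m ≡ b % m → m ℕ.∣ p ∸ b
  ≡-mod⇒∣-∸ p b eq = ℕ.divides (p / m ∸ b / m) (begin
    p ∸ b
      ≡⟨ cong₂ _∸_ (ℕ.m≡m%n+[m/n]*n p m) (ℕ.m≡m%n+[m/n]*n b m) ⟩
    (p % m + p / m * m) ∸ (b % m + b / m * m)
      ≡⟨ cong (λ r → (r + p / m * m) ∸ (b % m + b / m * m)) eq ⟩
    (b % m + p / m * m) ∸ (b % m + b / m * m)
      ≡⟨ ℕ.[m+n]∸[m+o]≡n∸o (b % m) _ _ ⟩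
    p / m * m ∸ b / m * m
      ≡⟨ ℕ.*-distribʳ-∸ m (p / m) (b / m) ⟨
    (p / m ∸ b / m) * m ∎)
    where open ≡-Reasoning

  private
    bottom-≤ : ∀ {p ps} → Linked _≥_ (p ∷ ps) → a ≤ p → bottom ps ≤ p
    bottom-≤ [-]         a≤p = a≤p
    bottom-≤ (p≥p′ ∷ _) _   = p≥p′

    bottom-% : ∀ {ps} → All InProgression ps → bottom ps % m ≡ a % m
    bottom-% []              = refl
    bottom-% ((_ , eq) ∷ _) = eq

  toParts-fromParts : ∀ {w} ps → length ps ≡ w → Linked _≥_ ps → All InProgression ps →
    toParts (fromParts w ps) ≡ ps
  toParts-fromParts []       refl _  _                     = refl
  toParts-fromParts {suc w} (p ∷ ps) refl dec ((a≤p , p%) ∷ ps%) = cong₂ _∷_ head-eq tail-eq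
    where
    open ≡-Reasoning
    js : Vec ℕ w
    js = fromParts w ps
    tail-eq : toParts js ≡ ps
    tail-eq = toParts-fromParts ps refl (Linked.tail dec) ps%
    b d : ℕ
    b = bottom ps
    d = (p ∸ b) / m
    m∣p∸b : m ℕ.∣ p ∸ b
    m∣p∸b = ≡-mod⇒∣-∸ p b (trans p% (sym (bottom-% ps%)))
    rearrange : ∀ a d S m → a + (d + S) * m ≡ d * m + (a + S * m)
    rearrange = solve-∀
    head-eq : a + (d + Vec.sum js) * m ≡ p
    head-eq = begin
      a + (d + Vec.sum js) * m       ≡⟨ rearrange a d (Vec.sum js) m ⟩
      d * m + (a + Vec.sum js * m)   ≡⟨ cong (d * m +_) (bottom-toParts js) ⟨
      d * m + bottom (toParts js)    ≡⟨ cong (λ l → d * m + bottom l) tail-eq ⟩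
      d * m + b                      ≡⟨ cong (_+ b) (ℕ.m/n*n≡m m∣p∸b) ⟩
      p ∸ b + b                      ≡⟨ ℕ.m∸n+n≡m (bottom-≤ dec a≤p) ⟩
      p ∎

  -- The sum of all sums of final segments, in which the i-th entry occurs i times.
  suffixSums : ∀ {w} → Vec ℕ w → ℕ
  suffixSums []       = 0
  suffixSums (j ∷ js) = (j + Vec.sum js) + suffixSums js

  dot-weights : ∀ {w} i (js : Vec ℕ w) →
    dot (weights m i w) js ≡ (i * Vec.sum js + suffixSums js) * m
  dot-weights i []       = cong (λ z → (z + 0) * m) (sym (ℕ.*-zeroʳ i))
  dot-weights i (j ∷ js) = begin
    j * suc (weight m i) + dot (weights m (suc i) _) js
      ≡⟨ cong₂ (λ u d → j * u + d) (suc-weight m i) (dot-weights (suc i) js) ⟩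
    j * (m * suc i) + (suc i * Vec.sum js + suffixSums js) * m
      ≡⟨ rearrange i j (Vec.sum js) (suffixSums js) m ⟩
    (i * (j + Vec.sum js) + ((j + Vec.sum js) + suffixSums js)) * m ∎
    where
    open ≡-Reasoning
    rearrange : ∀ i j S T m →
      j * (m * suc i) + (suc i * S + T) * m ≡ (i * (j + S) + ((j + S) + T)) * m
    rearrange = solve-∀

  sum-toParts : ∀ {w} (js : Vec ℕ w) → sum (toParts js) ≡ a * w + dot (weights m 0 w) js
  sum-toParts js = trans (go js) (cong (a * _ +_) (sym (dot-weights 0 js)))
    where
    rearrange : ∀ a w x m T → (a + x * m) + (a * w + T * m) ≡ a * suc w + (x + T) * m
    rearrange = solve-∀
    go : ∀ {w} (js : Vec ℕ w) → sum (toParts js) ≡ a * w + suffixSums js * m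
    go []       = sym (trans (ℕ.+-identityʳ _) (ℕ.*-zeroʳ a))
    go {suc w} (j ∷ js) =
      trans (cong (a + (j + Vec.sum js) * m +_) (go js))
            (rearrange a w (j + Vec.sum js) m (suffixSums js))

  partition : .{{_ : NonZero a}} → ∀ {w} → Vec ℕ w → Partition
  partition js = record
    { parts      = toParts js
    ; decreasing = toParts-decreasing js
    ; positive   = All.map (λ (a≤p , _) → ℕ.≤-trans (ℕ.>-nonZero⁻¹ a) a≤p)
                           (toParts-inProgression js)
    }

open Progression

Partition-≡ : ∀ {λ₁ λ₂ : Partition} → parts λ₁ ≡ parts λ₂ → λ₁ ≡ λ₂
Partition-≡ {record { parts = ps ; decreasing = d₁ ; positive = p₁ }}
            {record { parts = ps ; decreasing = d₂ ; positive = p₂ }} refl =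
  cong₂ (λ d p → record { parts = ps ; decreasing = d ; positive = p })
        (Linked.irrelevant ℕ.≤-irrelevant d₁ d₂) (All.irrelevant ℕ.<-irrelevant p₁ p₂)

-- The partition ρ, determined by the numbers w and s of parts of γ and σ.
rectangle : (m w s : ℕ) .{{_ : NonZero m}} → Partition
rectangle m w s = record
  { parts      = replicate (#ρ-parts w s) (m ℕ.* w)
  ; decreasing = constant-decreasing (#ρ-parts w s)
  ; positive   = positive w
  }
  where
  constant-decreasing : ∀ k {p} → Linked _≥_ (replicate k p)
  constant-decreasing 0             = []
  constant-decreasing 1             = [-]
  constant-decreasing (suc (suc k)) = ℕ.≤-refl ∷ constant-decreasing (suc k)
  positive : ∀ w → All (0 <_) (replicate (#ρ-parts w s) (m ℕ.* w))
  positive zero    = []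
  positive (suc w) = All.replicate⁺ s (ℕ.*-mono-≤ (ℕ.>-nonZero⁻¹ m) (s≤s (z≤n {w})))

sum-rectangle : ∀ m w s .{{_ : NonZero m}} → Partition.size (rectangle m w s) ≡ s ℕ.* (m ℕ.* w)
sum-rectangle m zero    s = sym (trans (cong (s ℕ.*_) (ℕ.*-zeroʳ m)) (ℕ.*-zeroʳ s))
sum-rectangle m (suc w) s = go s
  where
  go : ∀ s → sum (replicate s (m ℕ.* suc w)) ≡ s ℕ.* (m ℕ.* suc w)
  go zero    = refl
  go (suc s) = cong (m ℕ.* suc w ℕ.+_) (go s)

module _ {a b m : ℕ} .{{_ : NonZero m}} where
  open Copartition

  parts-ρ : (c : Copartition a b m) →
    parts (ρ c) ≡ parts (rectangle m (#ground c) (#sky c))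
  parts-ρ c = trans (go (parts (ρ c)) (ρ-parts c))
                    (cong (λ k → replicate k (m ℕ.* #ground c)) (ρ-count c))
    where
    go : ∀ {p} ps → All (_≡ p) ps → ps ≡ replicate (length ps) p
    go []       []          = refl
    go (_ ∷ ps) (refl ∷ eqs) = cong (_ ∷_) (go ps eqs)

  Copartition-≡ : ∀ {c d : Copartition a b m} →
    parts (γ c) ≡ parts (γ d) → parts (σ c) ≡ parts (σ d) → c ≡ d
  Copartition-≡ {c} {d} γ≡ σ≡ = go c d (Partition-≡ γ≡) (Partition-≡ ρ≡) (Partition-≡ σ≡)
    where
    ρ≡ : parts (ρ c) ≡ parts (ρ d)
    ρ≡ = trans (parts-ρ c) (trans
      (cong₂ (λ ps qs → parts (rectangle m (length ps) (length qs))) γ≡ σ≡) (sym (parts-ρ d)))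
    inProgression-irrelevant : ∀ {a p} → Irrelevant (InProgression a m p)
    inProgression-irrelevant (l₁ , e₁) (l₂ , e₂) =
      cong₂ _,_ (ℕ.≤-irrelevant l₁ l₂) (ℕ.≡-irrelevant e₁ e₂)
    go : ∀ c d → γ c ≡ γ d → ρ c ≡ ρ d → σ c ≡ σ d → c ≡ d
    go record { γ = γ ; ρ = ρ ; σ = σ ; γ-parts = g₁ ; σ-parts = s₁ ; ρ-count = n₁ ; ρ-parts = r₁ }
       record { γ = γ ; ρ = ρ ; σ = σ ; γ-parts = g₂ ; σ-parts = s₂ ; ρ-count = n₂ ; ρ-parts = r₂ }
       refl refl refl
      with refl ← All.irrelevant inProgression-irrelevant g₁ g₂
         | refl ← All.irrelevant inProgression-irrelevant s₁ s₂
         | refl ← ℕ.≡-irrelevant n₁ n₂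
         | refl ← All.irrelevant ℕ.≡-irrelevant r₁ r₂
      = refl

module Encoding (a b m : ℕ) .{{_ : NonZero a}} .{{_ : NonZero b}} .{{_ : NonZero m}} where
  open import Data.Nat.Base using (_+_; _*_)
  open Copartition

  -- Copartitions with w ground and s sky parts.
  module OfShape (w s : ℕ) where
    -- The copartition with the given differences of γ and of σ.
    copartition : Vec ℕ w → Vec ℕ s → Copartition a b m
    copartition js is = record
      { γ = partition a m js
      ; ρ = rectangle m (length (toParts a m js)) (length (toParts b m is))
      ; σ = partition b m is
      ; γ-parts = toParts-inProgression a m js
      ; σ-parts = toParts-inProgression b m is
      ; ρ-count = List.length-replicate _
      ; ρ-parts = All.replicate⁺ _ refl
      }

    copartitionWeights : Vec ℕ (w + s)
    copartitionWeights = weights m 0 w Vec.++ weights m 0 s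

    size-copartition : ∀ (js : Vec ℕ w) (is : Vec ℕ s) →
      size (copartition js is) ≡ offset a b m w s + dot copartitionWeights (js Vec.++ is)
    size-copartition js is = begin
      sum (toParts a m js) + Partition.size (ρ (copartition js is)) + sum (toParts b m is)
        ≡⟨ cong₂ _+_ (cong₂ _+_ (sum-toParts a m js) ρ-size) (sum-toParts b m is) ⟩
      (a * w + dot (weights m 0 w) js) + s * (m * w) + (b * s + dot (weights m 0 s) is)
        ≡⟨ rearrange (a * w) _ (s * (m * w)) (b * s) _ ⟩
      offset a b m w s + (dot (weights m 0 w) js + dot (weights m 0 s) is)
        ≡⟨ cong (offset a b m w s +_) (dot-++ (weights m 0 w) _ js is) ⟨
      offset a b m w s + dot copartitionWeights (js Vec.++ is) ∎
      where
      open ≡-Reasoning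
      rearrange : ∀ a x r b y → (a + x) + r + (b + y) ≡ (a + r + b) + (x + y)
      rearrange = solve-∀
      ρ-size : Partition.size (ρ (copartition js is)) ≡ s * (m * w)
      ρ-size = trans
        (cong₂ (λ w s → Partition.size (rectangle m w s))
               (length-toParts a m js) (length-toParts b m is))
        (sum-rectangle m w s)

    -- The differences of γ and of σ.
    ground : Copartition a b m → Vec ℕ w
    ground c = fromParts a m w (parts (γ c))

    sky : Copartition a b m → Vec ℕ s
    sky c = fromParts b m s (parts (σ c))

    copartition-ground-sky : ∀ c → #ground c ≡ w → #sky c ≡ s → copartition (ground c) (sky c) ≡ c
    copartition-ground-sky c #γ #σ = Copartition-≡
      (toParts-fromParts a m _ #γ (Partition.decreasing (γ c)) (γ-parts c))
      (toParts-fromParts b m _ #σ (Partition.decreasing (σ c)) (σ-parts c))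

    take++drop≡id : (v : Vec ℕ (w + s)) → take w v Vec.++ drop w v ≡ v
    take++drop≡id = Vec.take++drop≡id w

    -- Those of size n.
    OfShape : ℕ → Set
    OfShape n = Σ[ c ∈ Copartition a b m ] (#ground c ≡ w × #sky c ≡ s × size c ≡ n)

    OfShape-≡ : ∀ {n} {c d : OfShape n} → proj₁ c ≡ proj₁ d → c ≡ d
    OfShape-≡ {c = c , p₁ , q₁ , r₁} {d = .c , p₂ , q₂ , r₂} refl =
      cong (c ,_) (cong₂ _,_ (ℕ.≡-irrelevant p₁ p₂)
        (cong₂ _,_ (ℕ.≡-irrelevant q₁ q₂) (ℕ.≡-irrelevant r₁ r₂)))

    Solution↔OfShape : ∀ n → Solution (offset a b m w s) copartitionWeights n ↔ OfShape n
    Solution↔OfShape n = mk↔ₛ′ to from to-from from-to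
      where
      k : ℕ
      k = offset a b m w s
      us : Vec ℕ (w + s)
      us = copartitionWeights
      to : Solution k us n → OfShape n
      to (v , eq) = copartition js is , length-toParts a m js , length-toParts b m is ,
        trans (size-copartition js is) (trans (cong (λ v → k + dot us v) (take++drop≡id v)) eq)
        where
        js : Vec ℕ w
        js = take w v
        is : Vec ℕ s
        is = drop w v
      from : OfShape n → Solution k us n
      from (c , #γ , #σ , eq) = ground c Vec.++ sky c ,
        trans (sym (size-copartition (ground c) (sky c)))
              (trans (cong size (copartition-ground-sky c #γ #σ)) eq)
      to-from : ∀ c → to (from c) ≡ c
      to-from (c , #γ , #σ , eq) = OfShape-≡ (trans
        (cong₂ copartition (proj₁ split) (proj₂ split))
        (copartition-ground-sky c #γ #σ))
        where
        split : take w (ground c Vec.++ sky c) ≡ ground c × drop w (ground c Vec.++ sky c) ≡ sky c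
        split = Vec.++-injective (take w (ground c Vec.++ sky c)) (ground c)
          (take++drop≡id (ground c Vec.++ sky c))
      from-to : ∀ v → from (to v) ≡ v
      from-to (v , eq) = Solution-≡ {us = us} (trans
        (cong₂ Vec._++_ (fromParts-toParts a m (take w v)) (fromParts-toParts b m (drop w v)))
        (take++drop≡id v))

  cp-counts : CountsCopartitions a b m (cp a b m)
  cp-counts w s n = subst (λ us → Fin (count k us n) ↔ OfShape.OfShape w s n)
    (Vec.toList-++ (weights m 0 w) (weights m 0 s))
    (↔-trans (count-↔ k _ n) (OfShape.Solution↔OfShape w s n))
    where
    k : ℕ
    k = offset a b m w s

-- Recurrences for the numbers of copartitions

-- The Kronecker delta.
δ : ℕ → ℕ → ℕ
δ zero    zero    = 1
δ zero    (suc _) = 0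
δ (suc _) zero    = 0
δ (suc i) (suc j) = δ i j

-- Vanishing for n < w + s.
Bounded : (ℕ → ℕ → ℕ → ℕ) → Set
Bounded c = ∀ w s n → n < w ℕ.+ s → c w s n ≡ 0

-- The effect of multiplication by x and by y on the coefficients of x^s y^w.
shiftX shiftY : (ℕ → ℕ → ℕ) → (ℕ → ℕ → ℕ)
shiftX c w zero    = 0
shiftX c w (suc s) = c w s
shiftY c zero    s = 0
shiftY c (suc w) s = c w s

-- The effect of multiplication by q^k on the coefficients of q^n.
shiftQ : ℕ → (ℕ → ℕ) → (ℕ → ℕ)
shiftQ zero    c n       = c n
shiftQ (suc k) c zero    = 0
shiftQ (suc k) c (suc n) = shiftQ k c n

shiftQ-count : ∀ k j us n → shiftQ k (count j us) n ≡ count (k ℕ.+ j) us n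
shiftQ-count zero    j us n       = refl
shiftQ-count (suc k) j us zero    = refl
shiftQ-count (suc k) j us (suc n) = shiftQ-count k j us n

-- The counting function of copartitions without ground part.
skyCount : (b m w s n : ℕ) → ℕ
skyCount b m zero    s = count (b ℕ.* s) (cpWeights m 0 s)
skyCount b m (suc w) s = λ _ → 0

module _ (a b m : ℕ) where
  open import Data.Nat.Base using (_+_; _*_)

  cp-bounded : .{{_ : NonZero a}} .{{_ : NonZero b}} → Bounded (cp a b m)
  cp-bounded w s n n<w+s = count-< (offset a b m w s) (cpWeights m w s)
    (ℕ.<-≤-trans n<w+s (ℕ.+-mono-≤
      (ℕ.≤-trans (ℕ.m≤n*m w a) (ℕ.m≤m+n (a * w) (s * (m * w)))) (ℕ.m≤n*m s b)))

  cp-0 : ∀ s n → cp a b m 0 s n ≡ skyCount b m 0 s n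
  cp-0 s n = cong (λ k → count k (cpWeights m 0 s) n) (rearrange a b m s)
    where
    rearrange : ∀ a b m s → a * 0 + s * (m * 0) + b * s ≡ b * s
    rearrange = solve-∀

  module _ .{{_ : NonZero m}} where
    cp-suc-zero : ∀ w n → cp a b m (suc w) 0 n
      ≡ shiftQ a (cp a b m w 0) n + cp (m + a) b m (suc w) 0 n
    cp-suc-zero w n = begin
      cp a b m (suc w) 0 n
        ≡⟨ count-sucˡ m (offset a b m (suc w) 0) w 0 n ⟩
      count (offset a b m (suc w) 0) (cpWeights m w 0) n
        + count (offset a b m (suc w) 0 + m * suc w) (cpWeights m (suc w) 0) n
        ≡⟨ cong₂ (λ k l → count k (cpWeights m w 0) n + count l (cpWeights m (suc w) 0) n)
             (removed a b m w) (raised a b m w) ⟩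
      count (a + offset a b m w 0) (cpWeights m w 0) n + cp (m + a) b m (suc w) 0 n
        ≡⟨ cong (_+ cp (m + a) b m (suc w) 0 n)
             (shiftQ-count a (offset a b m w 0) (cpWeights m w 0) n) ⟨
      shiftQ a (cp a b m w 0) n + cp (m + a) b m (suc w) 0 n ∎
      where
      open ≡-Reasoning
      removed : ∀ a b m w → a * suc w + 0 * (m * suc w) + b * 0 ≡ a + (a * w + 0 * (m * w) + b * 0)
      removed = solve-∀
      raised : ∀ a b m w → a * suc w + 0 * (m * suc w) + b * 0 + m * suc w
        ≡ (m + a) * suc w + 0 * (m * suc w) + b * 0
      raised = solve-∀

    -- With e and f as below, splitting the first count on the left by the ground
    -- coordinate of weight m (w + 1) gives count e (cpWeights m w (suc s)) n and the
    -- second count on the right; splitting the first count on the right by the sky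
    -- coordinate of weight m (s + 1) gives count e (cpWeights m w (suc s)) n, too,
    -- since e = f + m (s + 1), and the second count on the left.
    cp-suc-suc : ∀ w s n →
      cp a b m (suc w) (suc s) n + shiftQ (a + b) (cp (m + a) b m w s) n
        ≡ shiftQ a (cp a b m w (suc s)) n + cp (m + a) b m (suc w) (suc s) n
    cp-suc-suc w s n = begin
      cp a b m (suc w) (suc s) n + shiftQ (a + b) (cp (m + a) b m w s) n
        ≡⟨ cong₂ _+_
             (trans (count-sucˡ m e w (suc s) n)
               (cong₂ (λ k l → count k W₁ n + count l W₂ n) (e≡ a b m w s) (raised a b m w s)))
             (trans (shiftQ-count (a + b) (offset (m + a) b m w s) W₀ n)
               (cong (λ k → count k W₀ n) (f≡ a b m w s))) ⟩
      (count (f + m * suc s) W₁ n + cp (m + a) b m (suc w) (suc s) n) + count f W₀ n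
        ≡⟨ rotate (count (f + m * suc s) W₁ n) _ (count f W₀ n) ⟩
      (count f W₀ n + count (f + m * suc s) W₁ n) + cp (m + a) b m (suc w) (suc s) n
        ≡⟨ cong (_+ cp (m + a) b m (suc w) (suc s) n) (count-sucʳ m f w s n) ⟨
      count f W₁ n + cp (m + a) b m (suc w) (suc s) n
        ≡⟨ cong (_+ cp (m + a) b m (suc w) (suc s) n)
             (shiftQ-count a (offset a b m w (suc s)) W₁ n) ⟨
      shiftQ a (cp a b m w (suc s)) n + cp (m + a) b m (suc w) (suc s) n ∎
      where
      open ≡-Reasoning
      e f : ℕ
      e = offset a b m (suc w) (suc s)
      f = a + offset a b m w (suc s)
      W₀ = cpWeights m w s
      W₁ = cpWeights m w (suc s)
      W₂ = cpWeights m (suc w) (suc s)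
      rotate : ∀ u v t → (u + v) + t ≡ (t + u) + v
      rotate = solve-∀
      e≡ : ∀ a b m w s → a * suc w + suc s * (m * suc w) + b * suc s
        ≡ (a + (a * w + suc s * (m * w) + b * suc s)) + m * suc s
      e≡ = solve-∀
      raised : ∀ a b m w s → a * suc w + suc s * (m * suc w) + b * suc s + m * suc w
        ≡ (m + a) * suc w + suc s * (m * suc w) + b * suc s
      raised = solve-∀
      f≡ : ∀ a b m w s → (a + b) + ((m + a) * w + s * (m * w) + b * s)
        ≡ a + (a * w + suc s * (m * w) + b * suc s)
      f≡ = solve-∀

    -- The equation F_a + x y qᵃ⁺ᵇ F_{a+m} = y qᵃ F_a + F_{a+m} at xˢ y^w qⁿ.
    cp-recurrence : ∀ w s n →
      cp a b m w s n
        + shiftX (shiftY (λ w s → shiftQ (a + b) (cp (m + a) b m w s) n)) w s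
      ≡ shiftY (λ w s → shiftQ a (cp a b m w s) n) w s + cp (m + a) b m w s n
    cp-recurrence zero    zero    n = trans (ℕ.+-identityʳ _)
      (cong (λ k → count k [] n) (rearrange a b m))
      where
      rearrange : ∀ a b m → a * 0 + 0 * (m * 0) + b * 0 ≡ (m + a) * 0 + 0 * (m * 0) + b * 0
      rearrange = solve-∀
    cp-recurrence zero    (suc s) n = trans (ℕ.+-identityʳ _)
      (cong (λ k → count k (cpWeights m 0 (suc s)) n) (rearrange a b m s))
      where
      rearrange : ∀ a b m s → a * 0 + suc s * (m * 0) + b * suc s
        ≡ (m + a) * 0 + suc s * (m * 0) + b * suc s
      rearrange = solve-∀
    cp-recurrence (suc w) zero    n = trans (ℕ.+-identityʳ _) (cp-suc-zero w n)
    cp-recurrence (suc w) (suc s) n = cp-suc-suc w s n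

  -- A copartition with a ground part has size at least a.
  cp-limit : ∀ w s n → n < a → cp a b m w s n ≡ skyCount b m w s n
  cp-limit zero    s n n<a = cp-0 s n
  cp-limit (suc w) s n n<a = count-< (offset a b m (suc w) s) (cpWeights m (suc w) s)
    (ℕ.<-≤-trans n<a (ℕ.≤-trans (ℕ.m≤m*n a (suc w)) (ℕ.≤-trans (ℕ.m≤m+n _ _) (ℕ.m≤m+n _ _))))

module _ (b m : ℕ) where
  open import Data.Nat.Base using (_+_; _*_)

  skyCount-bounded : .{{_ : NonZero b}} → Bounded (skyCount b m)
  skyCount-bounded zero    s n n<s =
    count-< (b * s) (cpWeights m 0 s) (ℕ.<-≤-trans n<s (ℕ.m≤n*m s b))
  skyCount-bounded (suc w) s n _   = refl

  -- The equation G_b = x qᵇ G_b + G_{b+m} at xˢ y^w qⁿ.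
  skyCount-recurrence : .{{_ : NonZero m}} → ∀ w s n → skyCount b m w s n
    ≡ shiftX (λ w s → shiftQ b (skyCount b m w s) n) w s + skyCount (m + b) m w s n
  skyCount-recurrence zero zero n =
    cong (λ k → count k (cpWeights m 0 0) n) (trans (ℕ.*-zeroʳ b) (sym (ℕ.*-zeroʳ (m + b))))
  skyCount-recurrence zero (suc s) n = begin
    count (b * suc s) (cpWeights m 0 (suc s)) n
      ≡⟨ count-sucʳ m (b * suc s) 0 s n ⟩
    count (b * suc s) (cpWeights m 0 s) n + count (b * suc s + m * suc s) (cpWeights m 0 (suc s)) n
      ≡⟨ cong₂ (λ k l → count k (cpWeights m 0 s) n + count l (cpWeights m 0 (suc s)) n)
           (ℕ.*-suc b s) (raised b m s) ⟩
    count (b + b * s) (cpWeights m 0 s) n + skyCount (m + b) m 0 (suc s) n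
      ≡⟨ cong (_+ skyCount (m + b) m 0 (suc s) n) (shiftQ-count b (b * s) (cpWeights m 0 s) n) ⟨
    shiftQ b (skyCount b m 0 s) n + skyCount (m + b) m 0 (suc s) n ∎
    where
    open ≡-Reasoning
    raised : ∀ b m s → b * suc s + m * suc s ≡ (m + b) * suc s
    raised = solve-∀
  skyCount-recurrence (suc w) zero    n = refl
  skyCount-recurrence (suc w) (suc s) n = sym (trans (ℕ.+-identityʳ _) (shiftQ-0 b n))
    where
    shiftQ-0 : ∀ k n → shiftQ k (λ _ → 0) n ≡ 0
    shiftQ-0 zero    n       = refl
    shiftQ-0 (suc k) zero    = refl
    shiftQ-0 (suc k) (suc n) = shiftQ-0 k n

  -- A sky part has size at least b, so below b only the empty copartition counts.
  skyCount-limit : ∀ w s n → n < b → skyCount b m w s n ≡ δ 0 w * δ 0 s * δ 0 n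
  skyCount-limit zero    zero    zero    _ rewrite ℕ.*-zeroʳ b = refl
  skyCount-limit zero    zero    (suc n) _ rewrite ℕ.*-zeroʳ b = refl
  skyCount-limit zero    (suc s) n n<b =
    count-< (b * suc s) (cpWeights m 0 (suc s)) (ℕ.<-≤-trans n<b (ℕ.m≤m*n b (suc s)))
  skyCount-limit (suc w) s       n n<b = refl

-- a + i m, with the summands m on the left.
raised : ℕ → ℕ → ℕ → ℕ
raised m a zero    = a
raised m a (suc i) = m ℕ.+ raised m a i

raised-nonZero : ∀ m a .{{_ : NonZero a}} i → NonZero (raised m a i)
raised-nonZero m a zero = ℕ.>-nonZero (ℕ.>-nonZero⁻¹ a)
raised-nonZero m a (suc i) =
  ℕ.>-nonZero (ℕ.≤-trans (ℕ.>-nonZero⁻¹ _ {{raised-nonZero m a i}}) (ℕ.m≤n+m _ m))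

≤-raised : ∀ m a .{{_ : NonZero m}} i → i ≤ raised m a i
≤-raised m a zero    = z≤n
≤-raised m a (suc i) = ℕ.+-mono-≤ (ℕ.>-nonZero⁻¹ m) (≤-raised m a i)

-- Coefficients of series over polynomials in x and y

open import Defs

-- The rings ℤ[x], ℤ[x,y] and ℤ[x,y][[q]].
module ℤ[x]P = PolynomialRing ℤ.+-*-commutativeRing
module ℤ[x,y]P = PolynomialRing ℤ[x]P.commutativeRing
module ℤ[x]R = CommutativeRing ℤ[x]P.commutativeRing
module ℤ[x,y]R = CommutativeRing ℤ[x,y]P.commutativeRing
module SR = CommutativeRing (SeriesRing.commutativeRing ℤ[x,y]P.commutativeRing)

-- The sum of the c i over i < N.
sumBelow : ℕ → (ℕ → ℕ) → ℕ
sumBelow zero    c = 0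
sumBelow (suc N) c = c 0 ℕ.+ sumBelow N (c ∘ suc)

sumBelow-cong : ∀ N {c d} → (∀ i → c i ≡ d i) → sumBelow N c ≡ sumBelow N d
sumBelow-cong zero    c≗d = refl
sumBelow-cong (suc N) c≗d = cong₂ ℕ._+_ (c≗d 0) (sumBelow-cong N (c≗d ∘ suc))

sumBelow-δ : ∀ N (c : ℕ → ℕ) j → (∀ i → N ≤ i → c i ≡ 0) → sumBelow N (λ i → c i ℕ.* δ i j) ≡ c j
sumBelow-δ zero    c j       c≡0 = sym (c≡0 j z≤n)
sumBelow-δ (suc N) c zero    c≡0 =
  trans (cong₂ ℕ._+_ (ℕ.*-identityʳ (c 0)) (sumBelow-0 N (c ∘ suc))) (ℕ.+-identityʳ (c 0))
  where
  sumBelow-0 : ∀ N (c : ℕ → ℕ) → sumBelow N (λ i → c i ℕ.* 0) ≡ 0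
  sumBelow-0 zero    c = refl
  sumBelow-0 (suc N) c = cong₂ ℕ._+_ (ℕ.*-zeroʳ (c 0)) (sumBelow-0 N (c ∘ suc))
sumBelow-δ (suc N) c (suc j) c≡0 =
  cong₂ ℕ._+_ (ℕ.*-zeroʳ (c 0))
        (sumBelow-δ N (c ∘ suc) j (λ i N≤i → c≡0 (suc i) (s≤s N≤i)))

module Coefficients where
  open ℤ[x,y] using (Poly; _·_) renaming (_+ᵖ_ to _+′_; _*_ to _*′_; _^_ to _^′_; x to X; y to Y)

  -- The polynomial p has coefficient c w s at x^s y^w.  A record, so that p and c can
  -- be inferred.
  record HasCoefficients (p : Poly) (c : ℕ → ℕ → ℕ) : Set where
    constructor coefficients
    field
      coefficient : ∀ w s → ℤ[x].coeff (ℤ[x,y].coeff p w) s ≡ ℤ.+ c w s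

  open HasCoefficients

  HasCoefficients-cong : ∀ {p r c} → p ℤ[x,y].≈ᵖ r → HasCoefficients r c → HasCoefficients p c
  HasCoefficients-cong p≈r rc = coefficients λ w s → trans (p≈r w s) (coefficient rc w s)

  HasCoefficients-≗ : ∀ {p c d} → (∀ w s → c w s ≡ d w s) →
    HasCoefficients p c → HasCoefficients p d
  HasCoefficients-≗ c≗d pc =
    coefficients λ w s → trans (coefficient pc w s) (cong ℤ.+_ (c≗d w s))

  HasCoefficients-0 : HasCoefficients [] (λ _ _ → 0)
  HasCoefficients-0 = coefficients λ _ _ → refl

  HasCoefficients-1 : HasCoefficients ℤ[x,y]R.1# (λ w s → δ 0 w ℕ.* δ 0 s)
  HasCoefficients-1 = coefficients λ
    { zero zero → refl ; zero (suc s) → refl ; (suc w) s → refl }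

  HasCoefficients-+ : ∀ {p r c d} → HasCoefficients p c → HasCoefficients r d →
    HasCoefficients (p +′ r) (λ w s → c w s ℕ.+ d w s)
  HasCoefficients-+ {p} {r} pc rd = coefficients λ w s →
    trans (ℤ[x,y]P.coeff-+ p r w s)
      (trans (ℤ[x]P.coeff-+ (ℤ[x,y].coeff p w) (ℤ[x,y].coeff r w) s)
        (cong₂ ℤ._+_ (coefficient pc w s) (coefficient rd w s)))

  HasCoefficients-· : ∀ {p c} k → HasCoefficients p c →
    HasCoefficients (k · p) (λ w s → k ℕ.* c w s)
  HasCoefficients-· zero    pc = HasCoefficients-0
  HasCoefficients-· (suc k) pc = HasCoefficients-+ pc (HasCoefficients-· k pc)

  HasCoefficients-sum : ∀ N {p : ℕ → Poly} {c : ℕ → ℕ → ℕ → ℕ} →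
    (∀ i → HasCoefficients (p i) (c i)) →
    HasCoefficients (ℤ[x,y].sum {N} (λ i → p (toℕ i))) (λ w s → sumBelow N (λ i → c i w s))
  HasCoefficients-sum zero    pc = HasCoefficients-0
  HasCoefficients-sum (suc N) pc =
    HasCoefficients-+ (pc 0) (HasCoefficients-sum N (λ i → pc (suc i)))

  HasCoefficients-x* : ∀ {p c} → HasCoefficients p c → HasCoefficients (X *′ p) (shiftX c)
  HasCoefficients-x* {p} {c} pc = coefficients λ w s →
    trans (ℤ[x,y]P.coeff-constant-* ℤ[x].variable′ p w s) (shifted w s)
    where
    shifted : ∀ w s → ℤ[x].coeff (ℤ[x].variable′ ℤ[x].*ᵖ ℤ[x,y].coeff p w) s ≡ ℤ.+ shiftX c w s
    shifted w zero    = ℤ[x]P.coeff-variable-*-zero (ℤ[x,y].coeff p w)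
    shifted w (suc s) =
      trans (ℤ[x]P.coeff-variable-*-suc (ℤ[x,y].coeff p w) s) (coefficient pc w s)

  HasCoefficients-y* : ∀ {p c} → HasCoefficients p c → HasCoefficients (Y *′ p) (shiftY c)
  HasCoefficients-y* {p} pc = coefficients λ
    { zero    s → ℤ[x,y]P.coeff-variable-*-zero p s
    ; (suc w) s → trans (ℤ[x,y]P.coeff-variable-*-suc p w s) (coefficient pc w s)
    }

  HasCoefficients-y^ : ∀ i → HasCoefficients (Y ^′ i) (λ w s → δ i w ℕ.* δ 0 s)
  HasCoefficients-y^ zero    = HasCoefficients-1
  HasCoefficients-y^ (suc i) = HasCoefficients-≗ (λ { zero s → refl ; (suc w) s → refl })
    (HasCoefficients-y* (HasCoefficients-y^ i))

  HasCoefficients-monomial : ∀ i j →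
    HasCoefficients (X ^′ j *′ Y ^′ i) (λ w s → δ i w ℕ.* δ j s)
  HasCoefficients-monomial i zero    =
    HasCoefficients-cong (ℤ[x,y]R.*-identityˡ (Y ^′ i)) (HasCoefficients-y^ i)
  HasCoefficients-monomial i (suc j) =
    HasCoefficients-cong (ℤ[x,y]R.*-assoc X (X ^′ j) (Y ^′ i))
      (HasCoefficients-≗ (λ { w zero → sym (ℕ.*-zeroʳ (δ i w)) ; w (suc s) → refl })
        (HasCoefficients-x* (HasCoefficients-monomial i j)))

open Coefficients

-- The series f is the sum of the c w s n x^s y^w q^n.  A record for the same reason.
record Counts (f : Series) (c : ℕ → ℕ → ℕ → ℕ) : Set where
  constructor counts
  field
    countsAt : ∀ n → HasCoefficients (f n) (λ w s → c w s n)

open Counts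

module _ where
  private module S = SeriesRing ℤ[x,y]P.commutativeRing

  Counts-+ : ∀ {f g c d} → Counts f c → Counts g d → Counts (f + g) (λ w s n → c w s n ℕ.+ d w s n)
  Counts-+ fc gd = counts λ n → HasCoefficients-+ (countsAt fc n) (countsAt gd n)

  Counts-x* : ∀ {f c} → Counts f c → Counts (x * f) (λ w s n → shiftX (λ w s → c w s n) w s)
  Counts-x* {f} fc = counts λ n →
    HasCoefficients-cong (S.constant-* ℤ[x,y].x f n) (HasCoefficients-x* (countsAt fc n))

  Counts-y* : ∀ {f c} → Counts f c → Counts (y * f) (λ w s n → shiftY (λ w s → c w s n) w s)
  Counts-y* {f} fc = counts λ n →
    HasCoefficients-cong (S.constant-* ℤ[x,y].y f n) (HasCoefficients-y* (countsAt fc n))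

  Counts-q^* : ∀ {f c} k → Counts f c → Counts (q ^ k * f) (λ w s → shiftQ k (c w s))
  Counts-q^* {f}     zero    fc = counts λ n →
    HasCoefficients-cong (S.*-identityˡ f n) (countsAt fc n)
  Counts-q^* {f} {c} (suc k) fc = counts λ n →
    HasCoefficients-cong (SR.*-assoc q (q ^ k) f n) (shifted n)
    where
    shifted : ∀ n → HasCoefficients ((q * (q ^ k * f)) n) (λ w s → shiftQ (suc k) (c w s) n)
    shifted zero    = HasCoefficients-cong (S.variable-*-zero (q ^ k * f)) HasCoefficients-0
    shifted (suc n) = HasCoefficients-cong (S.variable-*-suc (q ^ k * f) n)
                                           (countsAt (Counts-q^* k fc) n)

  Counts-1# : Counts 1# (λ w s n → δ 0 w ℕ.* δ 0 s ℕ.* δ 0 n)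
  Counts-1# = counts λ
    { zero    → HasCoefficients-≗ (λ w s → sym (ℕ.*-identityʳ _)) HasCoefficients-1
    ; (suc n) → HasCoefficients-≗ (λ w s → sym (ℕ.*-zeroʳ (δ 0 w ℕ.* δ 0 s))) HasCoefficients-0
    }

  Counts-unique : ∀ {f g c d} → Counts f c → Counts g d → ∀ n →
    (∀ w s → c w s n ≡ d w s n) → f n ℤ[x,y].≈ᵖ g n
  Counts-unique fc gd n c≗d w s = trans (coefficient (countsAt fc n) w s)
    (trans (cong ℤ.+_ (c≗d w s)) (sym (coefficient (countsAt gd n) w s)))
    where open HasCoefficients

-- The bound makes the truncation of the sums in each coefficient harmless.
Counts-generatingSeries : ∀ {c} → Bounded c → Counts (generatingSeries c) c
Counts-generatingSeries {c} c≡0 = counts λ n → HasCoefficients-≗ (collapse n)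
  (HasCoefficients-sum (suc n) (λ w → HasCoefficients-sum (suc n)
    (λ s → HasCoefficients-· (c w s n) (HasCoefficients-monomial w s))))
  where
  collapse : ∀ n w′ s′ → sumBelow (suc n) (λ w → sumBelow (suc n) (λ s →
    c w s n ℕ.* (δ w w′ ℕ.* δ s s′))) ≡ c w′ s′ n
  collapse n w′ s′ = begin
    sumBelow (suc n) (λ w → sumBelow (suc n) (λ s → c w s n ℕ.* (δ w w′ ℕ.* δ s s′)))
      ≡⟨ sumBelow-cong (suc n) (λ w → sumBelow-cong (suc n)
           (λ s → sym (ℕ.*-assoc (c w s n) (δ w w′) (δ s s′)))) ⟩
    sumBelow (suc n) (λ w → sumBelow (suc n) (λ s → c w s n ℕ.* δ w w′ ℕ.* δ s s′))
      ≡⟨ sumBelow-cong (suc n) (λ w → sumBelow-δ (suc n) (λ s → c w s n ℕ.* δ w w′) s′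
           (λ s n<s → cong (ℕ._* δ w w′) (c≡0 w s n (ℕ.≤-trans n<s (ℕ.m≤n+m s w))))) ⟩
    sumBelow (suc n) (λ w → c w s′ n ℕ.* δ w w′)
      ≡⟨ sumBelow-δ (suc n) (λ w → c w s′ n) w′
           (λ w n<w → c≡0 w s′ n (ℕ.≤-trans n<w (ℕ.m≤m+n w s′))) ⟩
    c w′ s′ n ∎
    where open ≡-Reasoning

-- The product formula

module ProductFormula (a b m : ℕ) .{{_ : NonZero a}} .{{_ : NonZero b}} .{{_ : NonZero m}} where
  open SeriesRing ℤ[x,y]P.commutativeRing
  open Truncation ℤ[x,y]P.commutativeRing
  private module P = FinitePochhammer (SeriesRing.commutativeRing ℤ[x,y]P.commutativeRing) (q ^ m)
  open Exponentiation SR.semiring using (^-homo-*)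

  -- The first arguments of the three Pochhammer products, with a (for Y and XY) or b (for X)
  -- raised by multiples of m.
  X Y XY : ℕ → Series
  X  j = x * q ^ raised m b j
  Y  i = y * q ^ raised m a i
  XY i = x * y * q ^ (raised m a i ℕ.+ b)

  -- The generating series of all copartitions, with a raised by multiples of m, and
  -- of those without ground part, with b raised by multiples of m.
  F G : ℕ → Series
  F i = generatingSeries (cp (raised m a i) b m)
  G j = generatingSeries (skyCount (raised m b j) m)

  F-counts : ∀ i → Counts (F i) (cp (raised m a i) b m)
  F-counts i = Counts-generatingSeries (cp-bounded (raised m a i) b m {{raised-nonZero m a i}})

  G-counts : ∀ j → Counts (G j) (skyCount (raised m b j) m)
  G-counts j =
    Counts-generatingSeries (skyCount-bounded (raised m b j) m {{raised-nonZero m b j}})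

  raise-exponent : ∀ u k l → l ≡ m ℕ.+ k → u * q ^ k * q ^ m ≈ u * q ^ l
  raise-exponent u k _ refl = begin
    u * q ^ k * q ^ m     ≈⟨ SR.*-assoc u (q ^ k) (q ^ m) ⟩
    u * (q ^ k * q ^ m)   ≈⟨ SR.*-congˡ {u} {q ^ k * q ^ m} {q ^ m * q ^ k}
                               (SR.*-comm (q ^ k) (q ^ m)) ⟩
    u * (q ^ m * q ^ k)   ≈⟨ SR.*-congˡ {u} {q ^ (m ℕ.+ k)} {q ^ m * q ^ k} (^-homo-* q m k) ⟨
    u * q ^ (m ℕ.+ k) ∎
    where open SetoidReasoning SR.setoid

  F-step : ∀ i → (1# - Y i) * F i ≈ (1# - XY i) * F (suc i)
  F-step i = P.factored {Y i} {XY i} {F i} {F (suc i)} equation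
    where
    α : ℕ
    α = raised m a i
    equation : F i + XY i * F (suc i) ≈ Y i * F i + F (suc i)
    equation = begin
      F i + x * y * q ^ (α ℕ.+ b) * F (suc i)
        ≈⟨ SR.+-congˡ {F i} {XY i * F (suc i)} {x * (y * (q ^ (α ℕ.+ b) * F (suc i)))} (begin
             x * y * q ^ (α ℕ.+ b) * F (suc i)     ≈⟨ SR.*-assoc (x * y) (q ^ (α ℕ.+ b)) (F (suc i)) ⟩
             x * y * (q ^ (α ℕ.+ b) * F (suc i))   ≈⟨ SR.*-assoc x y (q ^ (α ℕ.+ b) * F (suc i)) ⟩
             x * (y * (q ^ (α ℕ.+ b) * F (suc i))) ∎) ⟩
      F i + x * (y * (q ^ (α ℕ.+ b) * F (suc i)))
        ≈⟨ (λ n → Counts-unique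
             (Counts-+ (F-counts i) (Counts-x* (Counts-y* (Counts-q^* (α ℕ.+ b) (F-counts (suc i))))))
             (Counts-+ (Counts-y* (Counts-q^* α (F-counts i))) (F-counts (suc i)))
             n (λ w s → cp-recurrence α b m w s n)) ⟩
      y * (q ^ α * F i) + F (suc i)
        ≈⟨ SR.+-congʳ {F (suc i)} {Y i * F i} {y * (q ^ α * F i)} (SR.*-assoc y (q ^ α) (F i)) ⟨
      Y i * F i + F (suc i) ∎
      where open SetoidReasoning SR.setoid

  -- The equation for G in the form of the one for F, with 0 in the place of XY.
  G-step : ∀ j → (1# - X j) * G j ≈ (1# - 0#) * G (suc j)
  G-step j = P.factored {X j} {0#} {G j} {G (suc j)} equation
    where
    β : ℕ
    β = raised m b j
    equation : G j + 0# * G (suc j) ≈ X j * G j + G (suc j)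
    equation = begin
      G j + 0# * G (suc j)
        ≈⟨ SR.+-congˡ {G j} {0# * G (suc j)} {0#} (SR.zeroˡ (G (suc j))) ⟩
      G j + 0#
        ≈⟨ SR.+-identityʳ (G j) ⟩
      G j
        ≈⟨ (λ n → Counts-unique (G-counts j)
             (Counts-+ (Counts-x* (Counts-q^* β (G-counts j))) (G-counts (suc j)))
             n (λ w s → skyCount-recurrence β m w s n)) ⟩
      x * (q ^ β * G j) + G (suc j)
        ≈⟨ SR.+-congʳ {G (suc j)} {X j * G j} {x * (q ^ β * G j)} (SR.*-assoc x (q ^ β) (G j)) ⟨
      X j * G j + G (suc j) ∎
      where open SetoidReasoning SR.setoid

  -- (A; qᵐ)_N.
  ⟨_⟩_ : Series → ℕ → Series
  ⟨ A ⟩ N = partialPochhammer A (q ^ m) N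

  F-iterated : ∀ N → ⟨ Y 0 ⟩ N * F 0 ≈ ⟨ XY 0 ⟩ N * F N
  F-iterated = P.iterate Y XY F
    (λ i → raise-exponent y (raised m a i) (raised m a (suc i)) refl)
    (λ i → raise-exponent (x * y) (raised m a i ℕ.+ b) (raised m a (suc i) ℕ.+ b)
             (ℕ.+-assoc m (raised m a i) b))
    F-step

  G-iterated : ∀ N → ⟨ X 0 ⟩ N * G 0 ≈ G N
  G-iterated N = begin
    ⟨ X 0 ⟩ N * G 0 ≈⟨ P.iterate X (λ _ → 0#) G
      (λ j → raise-exponent x (raised m b j) (raised m b (suc j)) refl)
      (λ _ → SR.zeroˡ (q ^ m)) G-step N ⟩
    ⟨ 0# ⟩ N * G N  ≈⟨ SR.*-congʳ {G N} {⟨ 0# ⟩ N} {1#} (P.pochhammer-0# N) ⟩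
    1# * G N        ≈⟨ SR.*-identityˡ (G N) ⟩
    G N ∎
    where open SetoidReasoning SR.setoid

  F≈G : ∀ N → F N ≈[ N ] G 0
  F≈G N {n} n<N = Counts-unique (F-counts N) (G-counts 0) n
    (λ w s → cp-limit (raised m a N) b m w s n (ℕ.<-≤-trans n<N (≤-raised m a N)))

  G≈1 : ∀ N → G N ≈[ N ] 1#
  G≈1 N {n} n<N = Counts-unique (G-counts N) Counts-1# n
    (λ w s → skyCount-limit (raised m b N) m w s n (ℕ.<-≤-trans n<N (≤-raised m b N)))

  denominator : Series
  denominator = pochhammer∞ (X 0) (q ^ m) * pochhammer∞ (Y 0) (q ^ m)

  truncated : ∀ N → F 0 * denominator ≈[ N ] pochhammer∞ (XY 0) (q ^ m)
  truncated N {n} n<N = begin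
    (F 0 * denominator) n
      ≈⟨ *-congˡ-[] (F 0) {denominator} {⟨ X 0 ⟩ N * ⟨ Y 0 ⟩ N} N
           (*-cong-[] {pochhammer∞ (X 0) (q ^ m)} {⟨ X 0 ⟩ N} {pochhammer∞ (Y 0) (q ^ m)} {⟨ Y 0 ⟩ N} N
             (∞≈ (X 0)) (∞≈ (Y 0))) n<N ⟩
    (F 0 * (⟨ X 0 ⟩ N * ⟨ Y 0 ⟩ N)) n
      ≈⟨ x∙yz≈y∙zx (F 0) (⟨ X 0 ⟩ N) (⟨ Y 0 ⟩ N) n ⟩
    (⟨ X 0 ⟩ N * (⟨ Y 0 ⟩ N * F 0)) n
      ≈⟨ SR.*-congˡ {⟨ X 0 ⟩ N} {⟨ Y 0 ⟩ N * F 0} {⟨ XY 0 ⟩ N * F N} (F-iterated N) n ⟩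
    (⟨ X 0 ⟩ N * (⟨ XY 0 ⟩ N * F N)) n
      ≈⟨ x∙yz≈y∙xz (⟨ X 0 ⟩ N) (⟨ XY 0 ⟩ N) (F N) n ⟩
    (⟨ XY 0 ⟩ N * (⟨ X 0 ⟩ N * F N)) n
      ≈⟨ *-congˡ-[] (⟨ XY 0 ⟩ N) {⟨ X 0 ⟩ N * F N} {⟨ X 0 ⟩ N * G 0} N
           (*-congˡ-[] (⟨ X 0 ⟩ N) {F N} {G 0} N (F≈G N)) n<N ⟩
    (⟨ XY 0 ⟩ N * (⟨ X 0 ⟩ N * G 0)) n
      ≈⟨ SR.*-congˡ {⟨ XY 0 ⟩ N} {⟨ X 0 ⟩ N * G 0} {G N} (G-iterated N) n ⟩
    (⟨ XY 0 ⟩ N * G N) n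
      ≈⟨ *-congˡ-[] (⟨ XY 0 ⟩ N) {G N} {1#} N (G≈1 N) n<N ⟩
    (⟨ XY 0 ⟩ N * 1#) n
      ≈⟨ SR.*-identityʳ (⟨ XY 0 ⟩ N) n ⟩
    (⟨ XY 0 ⟩ N) n
      ≈⟨ ∞≈ (XY 0) n<N ⟨
    pochhammer∞ (XY 0) (q ^ m) n ∎
    where
    open SetoidReasoning ℤ[x,y]R.setoid
    open CommutativeSemigroupProperties SR.*-commutativeSemigroup using (x∙yz≈y∙zx; x∙yz≈y∙xz)
    ∞≈ : ∀ A → pochhammer∞ A (q ^ m) ≈[ N ] ⟨ A ⟩ N
    ∞≈ A = pochhammer∞-≈[] (q ^ m) (variable-^-vanishing m) A N

  denominator-0 : denominator 0 ℤ[x,y].≈ᵖ ℤ[x,y]R.1#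
  denominator-0 = begin
    denominator 0
      ≈⟨ *-cong-[] {pochhammer∞ (X 0) (q ^ m)} {1#} {pochhammer∞ (Y 0) (q ^ m)} {1#} 1
           (λ { (s≤s z≤n) → at-0 x b }) (λ { (s≤s z≤n) → at-0 y a }) (s≤s z≤n) ⟩
    (1# * 1#) 0
      ≈⟨ *-identityˡ 1# 0 ⟩
    ℤ[x,y]R.1# ∎
    where
    open SetoidReasoning ℤ[x,y]R.setoid
    at-0 : ∀ u k .{{_ : NonZero k}} → pochhammer∞ (u * q ^ k) (q ^ m) 0 ℤ[x,y].≈ᵖ ℤ[x,y]R.1#
    at-0 u k = pochhammer∞-0 (q ^ m) (variable-^-vanishing m) (u * q ^ k)
      (*-vanishing {q ^ k} u (variable-^-vanishing k))

  product-formula : generatingSeries (cp a b m) ≈ pochhammer∞ (XY 0) (q ^ m) / denominator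
  product-formula = /-unique {pochhammer∞ (XY 0) (q ^ m)} {denominator} {F 0}
    denominator-0 (λ n → truncated (suc n) ℕ.≤-refl)

theorem3p6 : (a b m : ℕ) .{{_ : NonZero a}} .{{_ : NonZero b}} .{{_ : NonZero m}} →
    Σ[ cp ∈ (ℕ → ℕ → ℕ → ℕ) ]
    ( CountsCopartitions a b m cp
    × generatingSeries cp ≈
    pochhammer∞ (x * y * q ^ (a ℕ.+ b)) (q ^ m)
    / (pochhammer∞ (x * q ^ b) (q ^ m) * pochhammer∞ (y * q ^ a) (q ^ m)) )
theorem3p6 a b m = cp a b m , Encoding.cp-counts a b m , ProductFormula.product-formula a b m
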